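{- Let $m\ge1$, $n=2m$, let $U$ be the cyclic subgroup of $\mathbb{F}_{2^n}^*$ of order $2^m+1$, and let $u_0\in U\setminus\{1\}$. Define $T_{u_0}:\mathbb{F}_{2^n}\to\mathbb{F}_{2^m}$ by $$T_{u_0}(x)=\mathrm{Tr}_m^n\Big(u_0\sum_{i=1}^{2^{m-1}}x^{i(2^m-1)}\Big).$$ Then $T_{u_0}$ is a vectorial hyper-bent function.
   Context: $\mathrm{Tr}_m^n(y)=y+y^{2^m}$ is the trace from $\mathbb{F}_{2^n}$ to $\mathbb{F}_{2^m}$, and $\mathrm{Tr}_1^n$ the absolute trace. A Boolean function $f:\mathbb{F}_{2^n}\to\mathbb{F}_2$ is hyper-bent if for every $\lambda\in\mathbb{F}_{2^n}$ and every integer $t$ with $\gcd(t,2^n-1)=1$, $\sum_{x\in\mathbb{F}_{2^n}}(-1)^{f(x)+\mathrm{Tr}_1^n(\lambda x^t)}\in\{\pm2^{n/2}\}$. A function $F:\mathbb{F}_{2^n}\to\mathbb{F}_{2^m}$ is vectorial hyper-bent if all its nonzero component functions $x\mapsto\mathrm{Tr}_1^m(bF(x))$, $b\in\mathbb{F}_{2^m}^*$, are hyper-bent (equivalently, all nonzero $\mathbb{F}_2$-linear combinations of its coordinate functions with respect to an $\mathbb{F}_2$-basis of $\mathbb{F}_{2^m}$ are hyper-bent).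
   Formalization: The statement is proved for m ≥ 2 instead of m ≥ 1: for m = 1 the function is T_{u_0}(x) = Tr_1^2(u_0 x), which is linear on F_4, and its character sum at λ = u_0, t = 1 is 4 rather than ±2, so the claim fails for every u_0. -}

module Defs where

open import Algebra.Bundles using (CommutativeRing)
import Algebra.Properties.CommutativeMonoid.Sum as Summation
import Algebra.Properties.Semiring.Exp as Exponentiation
open import Data.Bool.Base using (if_then_else_)
open import Data.Fin.Base using (Fin; toℕ)
import Data.Fin.Properties as Fin
open import Data.Integer.Base as ℤ using (ℤ; +_; -[1+_]; 1ℤ; -1ℤ)
import Data.Integer.GCD as ℤ
import Data.Integer.Properties as ℤ
open import Data.Nat.Base as ℕ using (ℕ; suc)
open import Data.Product.Base using (∃; _×_; proj₁)
open import Data.Sum.Base using (_⊎_)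
open import Function.Bundles using (Inverse)
open import Function.Definitions using (Congruent)
open import Function.Properties.Inverse using (Inverse⇒Injection) renaming (sym to Inverse-sym)
open import Level using (Level; _⊔_) renaming (suc to lsuc)
open import Relation.Binary.Bundles using (Setoid)
import Relation.Binary.Construct.On as On
open import Relation.Binary.Definitions using (Decidable; _Respects_)
open import Relation.Binary.PropositionalEquality.Core using (_≡_)
import Relation.Binary.PropositionalEquality.Properties as ≡
open import Relation.Nullary.Decidable using (does; yes; no; via-injection)
open import Relation.Nullary.Negation using (¬_)
open import Relation.Unary using (Pred; _∈_)

Cardinality : ∀ {a ℓ} → Setoid a ℓ → ℕ → Set (a ⊔ ℓ)
Cardinality S N = Inverse (≡.setoid (Fin N)) S

record FiniteField (c ℓ : Level) (q : ℕ) : Set (lsuc (c ⊔ ℓ)) where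
  field
    commutativeRing : CommutativeRing c ℓ

  open CommutativeRing commutativeRing public
  open Exponentiation semiring public using (_^_)
  open Summation +-commutativeMonoid public using (sum)

  field
    1≉0         : ¬ (1# ≈ 0#)
    inverse     : ∀ x → ¬ (x ≈ 0#) → ∃ λ y → x * y ≈ 1#
    cardinality : Cardinality setoid q

  _≟_ : Decidable _≈_
  _≟_ = via-injection (Inverse⇒Injection (Inverse-sym cardinality)) Fin._≟_

  infix 8 _⁻¹
  infixr 8 _^ℤ_

  -- Convention: 0⁻¹ = 0.
  _⁻¹ : Carrier → Carrier
  x ⁻¹ with x ≟ 0#
  ... | yes _  = 0#
  ... | no x≉0 = proj₁ (inverse x x≉0)

  -- By the convention above 0 ^ℤ t ≈ 0 for every t ≠ 0, so x ^ℤ t depends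
  -- only on t modulo q − 1 (for t ≠ 0), as usual for power maps on 𝔽_q.
  _^ℤ_ : Carrier → ℤ → Carrier
  x ^ℤ (+ k)    = x ^ k
  x ^ℤ -[1+ k ] = (x ⁻¹) ^ suc k

  subsetSetoid : ∀ {p} → Pred Carrier p → Setoid (c ⊔ p) ℓ
  subsetSetoid P = On.setoid {B = ∃ P} setoid proj₁

  record IsSubfieldOfOrder {p} (N : ℕ) (F : Pred Carrier p) : Set (c ⊔ ℓ ⊔ p) where
    field
      resp        : F Respects _≈_
      0∈          : 0# ∈ F
      1∈          : 1# ∈ F
      +-closed    : ∀ {x y} → x ∈ F → y ∈ F → x + y ∈ F
      neg-closed  : ∀ {x} → x ∈ F → - x ∈ F
      *-closed    : ∀ {x y} → x ∈ F → y ∈ F → x * y ∈ F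
      ⁻¹-closed   : ∀ {x} → x ∈ F → ¬ (x ≈ 0#) → x ⁻¹ ∈ F
      size        : Cardinality (subsetSetoid F) N

  -- Subgroups of the multiplicative group of nonzero elements.
  record IsCyclicSubgroupOfOrder {p} (N : ℕ) (U : Pred Carrier p) : Set (c ⊔ ℓ ⊔ p) where
    field
      resp        : U Respects _≈_
      nonzero     : ∀ {x} → x ∈ U → ¬ (x ≈ 0#)
      1∈          : 1# ∈ U
      *-closed    : ∀ {x y} → x ∈ U → y ∈ U → x * y ∈ U
      ⁻¹-closed   : ∀ {x} → x ∈ U → x ⁻¹ ∈ U
      generator   : Carrier
      generator∈  : generator ∈ U
      generates   : ∀ {x} → x ∈ U → ∃ λ (k : ℤ) → x ≈ generator ^ℤ k
      size        : Cardinality (subsetSetoid U) N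

  -- Tr₁ᵏ(y) = y + y² + y⁴ + ⋯ + y^(2ᵏ⁻¹).
  absTrace : ℕ → Carrier → Carrier
  absTrace k y = sum {k} λ i → y ^ (2 ℕ.^ toℕ i)

  sumℤ : (Carrier → ℤ) → ℤ
  sumℤ g = Summation.sum ℤ.+-0-commutativeMonoid λ i → g (Inverse.to cardinality i)

  -- (−1)^y for y in the prime field 𝔽₂ = {0, 1}; only used for such y.
  sign : Carrier → ℤ
  sign y = if does (y ≟ 0#) then 1ℤ else -1ℤ

  -- A function to 𝔽₂, regarded as the prime field {0, 1} of the given field.
  record IsBoolean (f : Carrier → Carrier) : Set (c ⊔ ℓ) where
    field
      cong   : Congruent _≈_ _≈_ f
      values : ∀ x → f x ≈ 0# ⊎ f x ≈ 1#

-- K is 𝔽_{2ⁿ} with n = 2m.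
module HyperBentness {c ℓ : Level} (m : ℕ) (K : FiniteField c ℓ (2 ℕ.^ (2 ℕ.* m))) where
  open FiniteField K

  n : ℕ
  n = 2 ℕ.* m

  walsh : (Carrier → Carrier) → Carrier → ℤ → ℤ
  walsh f λ′ t = sumℤ λ x → sign (f x + absTrace n (λ′ * x ^ℤ t))

  record IsHyperBent (f : Carrier → Carrier) : Set (c ⊔ ℓ) where
    field
      boolean  : IsBoolean f
      spectrum : ∀ (λ′ : Carrier) (t : ℤ) → ℤ.gcd t (+ (2 ℕ.^ n ℕ.∸ 1)) ≡ 1ℤ →
                 walsh f λ′ t ≡ + (2 ℕ.^ m) ⊎ walsh f λ′ t ≡ ℤ.- (+ (2 ℕ.^ m))

  -- 𝔽 is the subfield 𝔽_{2ᵐ} of K; a function K → 𝔽_{2ᵐ} is a function on K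
  -- with values in 𝔽.
  record IsVectorialHyperBent {p} (𝔽 : Pred Carrier p) (F : Carrier → Carrier) : Set (c ⊔ ℓ ⊔ p) where
    field
      cong       : Congruent _≈_ _≈_ F
      values     : ∀ x → F x ∈ 𝔽
      components : ∀ b → b ∈ 𝔽 → ¬ (b ≈ 0#) → IsHyperBent λ x → absTrace m (b * F x)

  -- Trₘⁿ(y) = y + y^(2ᵐ).
  relTrace : Carrier → Carrier
  relTrace y = y + y ^ (2 ℕ.^ m)

  -- The summation index is i = suc (toℕ j), running from 1 to 2ᵐ⁻¹.
  T : Carrier → Carrier → Carrier
  T u₀ x = relTrace (u₀ * sum {2 ℕ.^ (m ℕ.∸ 1)} λ j → x ^ (suc (toℕ j) ℕ.* (2 ℕ.^ m ℕ.∸ 1)))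

{-# OPTIONS --safe #-}
module Submission where

-- Write q = 2ᵐ, z̄ = z^q, and let χ be the additive character of 𝔽_q given by
-- the sign of the absolute trace.  The theorem rests on the closed form
--   T_{u₀}(z²) = Trₘⁿ(u₀ z̄) / Trₘⁿ(z)      (with 1/0 = 0),
-- which comes from summing the geometric progression.  It shows that T_{u₀} is
-- unchanged when its argument is multiplied by an element of 𝔽_q*.  For b ≠ 0
-- put s(x) = χ(b T_{u₀}(x)).
--
-- The translation z ↦ z + y with y ∈ 𝔽_q adds y Trₘⁿ(u₀) / Trₘⁿ(z) to T_{u₀}(z²),
-- and Trₘⁿ(u₀) ≠ 0.  Averaging over y kills every z outside 𝔽_q, so Σ s(x) = q.
--
-- For λ ≠ 0, averaging the Walsh sum over the dilations x ↦ y x with y ∈ 𝔽_q*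
-- leaves only the x with Trₘⁿ(λ xᵗ) = 0.  As t is invertible modulo q² − 1, they
-- form a set {0} ∪ x₀ 𝔽_q*, on which s takes the values 1 and s(x₀).  Together
-- with Σ s(x) = q this gives the Walsh value q s(x₀) = ±q.

open import Defs
open import Algebra.Bundles using (AbelianGroup; CommutativeMonoid)
import Algebra.Properties.CommutativeMonoid.Sum as Summation
import Algebra.Properties.CommutativeSemiring.Exp as CommutativeExp
import Algebra.Properties.Group as GroupProperties
import Algebra.Properties.Semiring.Exp as Exp
import Algebra.Properties.Semiring.Mult as Mult
import Algebra.Properties.Semiring.Sum as SemiringSum
import Algebra.Solver.Ring.NaturalCoefficients.Default as SemiringSolver
open import Data.Bool.Base using (if_then_else_)
open import Data.Fin.Base using (Fin; zero; suc; toℕ; punchIn; inject≤)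
open import Data.Fin.Permutation using (permutation)
import Data.Fin.Properties as Fin
open import Data.Integer.Base as ℤ using (ℤ; +_; -[1+_]; 0ℤ; 1ℤ; -1ℤ)
import Data.Integer.GCD as ℤ
import Data.Integer.Properties as ℤ
open import Data.Integer.Tactic.RingSolver using (solve-∀)
open import Data.Nat.Base as ℕ using (ℕ; zero; suc; _≤_; z≤n; s≤s; _∸_)
open import Data.Nat.Coprimality using (Coprime; coprime-Bézout; gcd≡1⇒coprime; 0-coprimeTo-m⇒m≡1)
open import Data.Nat.GCD using (module Bézout)
import Data.Nat.Properties as ℕ
open import Data.Product.Base using (∃; ∃₂; _×_; _,_; proj₁; proj₂)
open import Data.Sum.Base using (_⊎_; inj₁; inj₂)
open import Data.Unit.Base using (⊤; tt)
open import Function.Base using (_∘_)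
open import Function.Bundles using (Inverse)
open import Function.Definitions using (Congruent)
open import Level using (Level; _⊔_; 0ℓ)
open import Relation.Binary.Bundles using (Setoid)
open import Relation.Binary.PropositionalEquality as ≡ using (_≡_; _≢_)
import Relation.Binary.Reasoning.Setoid as SetoidReasoning
open import Relation.Nullary.Decidable using (Dec; yes; no; dec-true; dec-false)
open import Relation.Nullary.Negation using (¬_; contradiction)
open import Relation.Unary using (Pred; _∈_)

-- Listings and permutations of subsets of a setoid.

module _ {c ℓ} (S : Setoid c ℓ) where
  open Setoid S

  -- A bijection of `Fin N` with the `≈`-classes that meet `P`. Elements and membership proofs are
  -- separate fields, so that one listing can serve two predicates with the same members, as in
  -- `enumerateFixed`.
  record Enumeration {p} (P : Pred Carrier p) (N : ℕ) : Set (c ⊔ ℓ ⊔ p) where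
    field
      elem           : Fin N → Carrier
      elem∈          : ∀ i → elem i ∈ P
      elem-injective : ∀ {i j} → elem i ≈ elem j → i ≡ j
      index          : ∀ {x} → x ∈ P → Fin N
      elem-index     : ∀ {x} (x∈P : x ∈ P) → elem (index x∈P) ≈ x

  -- Both maps are total on the carrier and the inverse laws are asked on `P` alone, so dilations,
  -- translations and powers of the field act on a subset without being restricted to it first.
  record PermutationOn {p} (P : Pred Carrier p) (φ : Carrier → Carrier) : Set (c ⊔ ℓ ⊔ p) where
    field
      inv      : Carrier → Carrier
      cong     : Congruent _≈_ _≈_ φ
      inv-cong : Congruent _≈_ _≈_ inv
      closed   : ∀ {x} → x ∈ P → φ x ∈ P
      inv∈     : ∀ {x} → x ∈ P → inv x ∈ P
      φ-inv    : ∀ {x} → x ∈ P → φ (inv x) ≈ x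
      inv-φ    : ∀ {x} → x ∈ P → inv (φ x) ≈ x

-- Reindexing and restriction of finite sums in a commutative monoid.

module Sums {a b} (M : CommutativeMonoid a b) where
  open CommutativeMonoid M
  open Summation M public

  sum-zero : ∀ {N} (f : Fin N → Carrier) → (∀ i → f i ≈ ε) → sum f ≈ ε
  sum-zero {N} f f≈ε = trans (sum-cong-≋ f≈ε) (sum-replicate-zero N)

  sum-single : ∀ {N} (f : Fin N → Carrier) i₀ → (∀ i → i ≢ i₀ → f i ≈ ε) → sum f ≈ f i₀
  sum-single {suc N} f i₀ vanish = begin
    sum f                               ≈⟨ sum-remove {i = i₀} f ⟩
    f i₀ ∙ sum (λ j → f (punchIn i₀ j)) ≈⟨ ∙-congˡ (sum-zero _ (λ j → vanish _ (Fin.punchInᵢ≢i i₀ j))) ⟩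
    f i₀ ∙ ε                            ≈⟨ identityʳ _ ⟩
    f i₀                                ∎
    where open SetoidReasoning setoid

  module _ {c ℓ} {S : Setoid c ℓ} where
    private module S = Setoid S

    sum-reindex : ∀ {p} {P : Pred S.Carrier p} {N} (E : Enumeration S P N) {φ} → PermutationOn S P φ →
                  (g : S.Carrier → Carrier) → Congruent S._≈_ _≈_ g →
                  sum (λ i → g (Enumeration.elem E i)) ≈ sum (λ i → g (φ (Enumeration.elem E i)))
    sum-reindex {N = N} E {φ} π g g-cong = begin
      sum (λ i → g (elem i))                              ≈⟨ sum-permute _ (permutation to from to-from from-to) ⟩
      sum (λ i → g (elem (index (closed (elem∈ i)))))     ≈⟨ sum-cong-≋ {N} (λ i → g-cong (elem-index _)) ⟩
      sum (λ i → g (φ (elem i)))                          ∎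
      where
      open SetoidReasoning setoid
      open Enumeration E
      open PermutationOn π
      to : _
      to i = index (closed (elem∈ i))
      from : _
      from i = index (inv∈ (elem∈ i))
      to-from : ∀ i → to (from i) ≡ i
      to-from i = elem-injective (S.trans (elem-index _) (S.trans (cong (elem-index _)) (φ-inv (elem∈ i))))
      from-to : ∀ i → from (to i) ≡ i
      from-to i = elem-injective (S.trans (elem-index _) (S.trans (inv-cong (elem-index _)) (inv-φ (elem∈ i))))

    -- Double counting in a matrix with the entry `g (E.elem i)` where the i-th element of `P` is
    -- the j-th element of `P′`, and `ε` elsewhere. Injectivity of the listings leaves at most one
    -- such entry in each row and column; rows add up to the left side, columns to the right side.
    sum-supported : ∀ {p p′} {P : Pred S.Carrier p} {P′ : Pred S.Carrier p′} {N N′} →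
      (E : Enumeration S P N) (E′ : Enumeration S P′ N′) →
      (∀ {x} → x ∈ P′ → x ∈ P) → (∀ x → Dec (x ∈ P′)) →
      (∀ x y → Dec (x S.≈ y)) →
      (g : S.Carrier → Carrier) → Congruent S._≈_ _≈_ g →
      (∀ {x} → x ∈ P → ¬ (x ∈ P′) → g x ≈ ε) →
      sum (λ i → g (Enumeration.elem E i)) ≈ sum (λ i → g (Enumeration.elem E′ i))
    sum-supported {N = N} {N′} E E′ P′⊆P P′? _≟_ g g-cong vanish = begin
      sum (λ i → g (E.elem i))         ≈⟨ sum-cong-≋ (λ i → sym (row i)) ⟩
      sum (λ i → sum (λ j → term i j)) ≈⟨ ∑-comm term ⟩
      sum (λ j → sum (λ i → term i j)) ≈⟨ sum-cong-≋ column ⟩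
      sum (λ j → g (E′.elem j))        ∎
      where
      open SetoidReasoning setoid
      module E = Enumeration E
      module E′ = Enumeration E′
      term : Fin N → Fin N′ → Carrier
      term i j with E.elem i ≟ E′.elem j
      ... | yes _ = g (E.elem i)
      ... | no _  = ε
      term-yes : ∀ i j → E.elem i S.≈ E′.elem j → term i j ≈ g (E.elem i)
      term-yes i j eq with E.elem i ≟ E′.elem j
      ... | yes _ = refl
      ... | no ≉  = contradiction eq ≉
      term-no : ∀ i j → ¬ (E.elem i S.≈ E′.elem j) → term i j ≈ ε
      term-no i j ≉ with E.elem i ≟ E′.elem j
      ... | yes eq = contradiction eq ≉
      ... | no _   = refl
      column : ∀ j → sum (λ i → term i j) ≈ g (E′.elem j)
      column j = trans
        (sum-single _ i₀ (λ i i≢i₀ → term-no i j λ eq →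
          i≢i₀ (E.elem-injective (S.trans eq (S.sym (E.elem-index _))))))
        (trans (term-yes i₀ j (E.elem-index _)) (g-cong (E.elem-index _)))
        where i₀ = E.index (P′⊆P (E′.elem∈ j))
      row : ∀ i → sum (λ j → term i j) ≈ g (E.elem i)
      row i with P′? (E.elem i)
      ... | yes ∈P′ = trans
        (sum-single _ j₀ (λ j j≢j₀ → term-no i j λ eq →
          j≢j₀ (E′.elem-injective (S.trans (S.sym eq) (S.sym (E′.elem-index _))))))
        (term-yes i j₀ (S.sym (E′.elem-index _)))
        where j₀ = E′.index ∈P′
      ... | no ∉P′ = trans
        (sum-zero _ (λ j → both j))
        (sym (vanish (E.elem∈ i) ∉P′))
        where
        -- `P′` is not assumed to respect `≈`, so a match with a listed element of `P′` cannot be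
        -- refuted here; the entry is trivial in either case.
        both : ∀ j → term i j ≈ ε
        both j with E.elem i ≟ E′.elem j
        ... | yes _ = vanish (E.elem∈ i) ∉P′
        ... | no _  = refl

-- Finite fields: inverses, the theorems of Lagrange and Fermat, roots of polynomials.

module FieldProperties {c ℓ N} (K : FiniteField c ℓ N) where
  open FiniteField K hiding (zero)
  open Exp semiring public using (^-congˡ; ^-congʳ; ^-homo-*; ^-assocʳ)
  open CommutativeExp commutativeSemiring public using (^-distrib-*)
  open SetoidReasoning setoid
  private
    module Solver = SemiringSolver commutativeSemiring
    module Product = Sums *-commutativeMonoid
    module Sum = Sums +-commutativeMonoid

  enumerate : ∀ {p} {P : Pred Carrier p} {k} → Cardinality (subsetSetoid P) k → Enumeration setoid P k
  enumerate card = record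
    { elem = λ i → proj₁ (to i)
    ; elem∈ = λ i → proj₂ (to i)
    ; elem-injective = λ {i} {j} eq →
        ≡.trans (≡.sym (strictlyInverseʳ i)) (≡.trans (from-cong eq) (strictlyInverseʳ j))
    ; index = λ {x} x∈P → from (x , x∈P)
    ; elem-index = λ {x} x∈P → strictlyInverseˡ (x , x∈P)
    }
    where open Inverse card

  Everything : Pred Carrier 0ℓ
  Everything _ = ⊤

  enumerateAll : Enumeration setoid Everything N
  enumerateAll = record
    { elem = to
    ; elem∈ = λ _ → tt
    ; elem-injective = λ {i} {j} eq →
        ≡.trans (≡.sym (strictlyInverseʳ i)) (≡.trans (from-cong eq) (strictlyInverseʳ j))
    ; index = λ {x} _ → from x
    ; elem-index = λ {x} _ → strictlyInverseˡ x
    }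
    where open Inverse cardinality

  1^n≈1 : ∀ k → 1# ^ k ≈ 1#
  1^n≈1 zero = refl
  1^n≈1 (suc k) = trans (*-identityˡ _) (1^n≈1 k)

  0^n≈0 : ∀ {k} → 1 ≤ k → 0# ^ k ≈ 0#
  0^n≈0 (s≤s _) = zeroˡ _

  ⁻¹-inverseʳ : ∀ {x} → ¬ (x ≈ 0#) → x * x ⁻¹ ≈ 1#
  ⁻¹-inverseʳ {x} x≉0 with x ≟ 0#
  ... | yes x≈0 = contradiction x≈0 x≉0
  ... | no x≉0′ = proj₂ (inverse x x≉0′)

  ⁻¹-inverseˡ : ∀ {x} → ¬ (x ≈ 0#) → x ⁻¹ * x ≈ 1#
  ⁻¹-inverseˡ x≉0 = trans (*-comm _ _) (⁻¹-inverseʳ x≉0)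

  x≈0⇒x⁻¹≈0 : ∀ {x} → x ≈ 0# → x ⁻¹ ≈ 0#
  x≈0⇒x⁻¹≈0 {x} x≈0 with x ≟ 0#
  ... | yes _  = refl
  ... | no x≉0 = contradiction x≈0 x≉0

  *-cancelˡ : ∀ {x y z} → ¬ (x ≈ 0#) → x * y ≈ x * z → y ≈ z
  *-cancelˡ {x} {y} {z} x≉0 eq = begin
    y              ≈⟨ *-identityˡ y ⟨
    1# * y         ≈⟨ *-congʳ (⁻¹-inverseˡ x≉0) ⟨
    x ⁻¹ * x * y   ≈⟨ *-assoc _ _ _ ⟩
    x ⁻¹ * (x * y) ≈⟨ *-congˡ eq ⟩
    x ⁻¹ * (x * z) ≈⟨ *-assoc _ _ _ ⟨
    x ⁻¹ * x * z   ≈⟨ *-congʳ (⁻¹-inverseˡ x≉0) ⟩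
    1# * z         ≈⟨ *-identityˡ z ⟩
    z              ∎

  x*y≈0⇒y≈0 : ∀ {x y} → ¬ (x ≈ 0#) → x * y ≈ 0# → y ≈ 0#
  x*y≈0⇒y≈0 x≉0 eq = *-cancelˡ x≉0 (trans eq (sym (zeroʳ _)))

  *-nonzero : ∀ {x y} → ¬ (x ≈ 0#) → ¬ (y ≈ 0#) → ¬ (x * y ≈ 0#)
  *-nonzero x≉0 y≉0 eq = y≉0 (x*y≈0⇒y≈0 x≉0 eq)

  ^-nonzero : ∀ {x} k → ¬ (x ≈ 0#) → ¬ (x ^ k ≈ 0#)
  ^-nonzero zero x≉0 = 1≉0
  ^-nonzero (suc k) x≉0 = *-nonzero x≉0 (^-nonzero k x≉0)

  ⁻¹-nonzero : ∀ {x} → ¬ (x ≈ 0#) → ¬ (x ⁻¹ ≈ 0#)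
  ⁻¹-nonzero x≉0 eq = 1≉0 (trans (sym (⁻¹-inverseʳ x≉0)) (trans (*-congˡ eq) (zeroʳ _)))

  *≈1⇒nonzero : ∀ {x y} → x * y ≈ 1# → ¬ (x ≈ 0#)
  *≈1⇒nonzero xy≈1 x≈0 = 1≉0 (trans (sym xy≈1) (trans (*-congʳ x≈0) (zeroˡ _)))

  ⁻¹-unique : ∀ {x y} → x * y ≈ 1# → y ≈ x ⁻¹
  ⁻¹-unique xy≈1 = *-cancelˡ x≉0 (trans xy≈1 (sym (⁻¹-inverseʳ x≉0)))
    where x≉0 = *≈1⇒nonzero xy≈1

  ⁻¹-cong : Congruent _≈_ _≈_ _⁻¹
  ⁻¹-cong {x} {y} x≈y with y ≟ 0#
  ... | yes y≈0 = x≈0⇒x⁻¹≈0 (trans x≈y y≈0)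
  ... | no y≉0 = sym (⁻¹-unique (trans (*-congʳ x≈y) (proj₂ (inverse y y≉0))))

  ⁻¹-involutive : ∀ {x} → ¬ (x ≈ 0#) → x ⁻¹ ⁻¹ ≈ x
  ⁻¹-involutive x≉0 = sym (⁻¹-unique (⁻¹-inverseˡ x≉0))

  *-permutation : ∀ {p} {P : Pred Carrier p} {a} → ¬ (a ≈ 0#) →
                  (∀ {x} → x ∈ P → a * x ∈ P) → (∀ {x} → x ∈ P → a ⁻¹ * x ∈ P) →
                  PermutationOn setoid P (a *_)
  *-permutation {a = a} a≉0 closed inv∈ = record
    { inv = a ⁻¹ *_
    ; cong = *-congˡ
    ; inv-cong = *-congˡ
    ; closed = closed
    ; inv∈ = inv∈
    ; φ-inv = λ _ → trans (sym (*-assoc _ _ _)) (trans (*-congʳ (⁻¹-inverseʳ a≉0)) (*-identityˡ _))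
    ; inv-φ = λ _ → trans (sym (*-assoc _ _ _)) (trans (*-congʳ (⁻¹-inverseˡ a≉0)) (*-identityˡ _))
    }

  private
    -- Zero is replaced by one, so that the product over a set containing zero can still be
    -- cancelled.
    nonzeroPart : Carrier → Carrier
    nonzeroPart x with x ≟ 0#
    ... | yes _ = 1#
    ... | no _  = x

    nonzeroPart-nonzero : ∀ x → ¬ (nonzeroPart x ≈ 0#)
    nonzeroPart-nonzero x with x ≟ 0#
    ... | yes _  = 1≉0
    ... | no x≉0 = x≉0

    nonzeroPart-cong : Congruent _≈_ _≈_ nonzeroPart
    nonzeroPart-cong {x} {y} x≈y with x ≟ 0# | y ≟ 0#
    ... | yes _   | yes _   = refl
    ... | yes x≈0 | no y≉0  = contradiction (trans (sym x≈y) x≈0) y≉0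
    ... | no x≉0  | yes y≈0 = contradiction (trans x≈y y≈0) x≉0
    ... | no _    | no _    = x≈y

    -- The factor by which `nonzeroPart` fails to commute with multiplication by `a`: at zero one
    -- side is `1#` and the other is `a`.
    atZero : Carrier → Carrier → Carrier
    atZero a x with x ≟ 0#
    ... | yes _ = a
    ... | no _  = 1#

    atZero-nonzero : ∀ {a x} → ¬ (x ≈ 0#) → atZero a x ≈ 1#
    atZero-nonzero {a} {x} x≉0 with x ≟ 0#
    ... | yes x≈0 = contradiction x≈0 x≉0
    ... | no _  = refl

    atZero-zero : ∀ {a x} → x ≈ 0# → atZero a x ≈ a
    atZero-zero {a} {x} x≈0 with x ≟ 0#
    ... | yes _  = refl
    ... | no x≉0 = contradiction x≈0 x≉0

    scale : ∀ {a} → ¬ (a ≈ 0#) → ∀ x → nonzeroPart (a * x) * atZero a x ≈ a * nonzeroPart x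
    scale {a} a≉0 x with x ≟ 0# | (a * x) ≟ 0#
    ... | yes _   | yes _    = *-comm _ _
    ... | yes x≈0 | no ax≉0  = contradiction (trans (*-congˡ x≈0) (zeroʳ a)) ax≉0
    ... | no x≉0  | yes ax≈0 = contradiction ax≈0 (*-nonzero a≉0 x≉0)
    ... | no _    | no _     = *-identityʳ _

    product-nonzero : ∀ {k} (f : Fin k → Carrier) → (∀ i → ¬ (f i ≈ 0#)) → ¬ (Product.sum f ≈ 0#)
    product-nonzero {zero} f f≉0 = 1≉0
    product-nonzero {suc k} f f≉0 = *-nonzero (f≉0 zero) (product-nonzero (f ∘ suc) (f≉0 ∘ suc))

    -- Multiplication by a permutes P, so the product of the nonzero elements
    -- of P is unchanged when each of them is multiplied by a.
    product-scaling : ∀ {p} {P : Pred Carrier p} {k a} (E : Enumeration setoid P k) → ¬ (a ≈ 0#) →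
      PermutationOn setoid P (a *_) → Product.sum (λ i → atZero a (Enumeration.elem E i)) ≈ a ^ k
    product-scaling {k = k} {a} E a≉0 π = *-cancelˡ (product-nonzero _ (λ i → nonzeroPart-nonzero (elem i))) (begin
      Product.sum (λ i → nonzeroPart (elem i)) * Product.sum (λ i → atZero a (elem i))
        ≈⟨ *-congʳ (Product.sum-reindex E π nonzeroPart nonzeroPart-cong) ⟩
      Product.sum (λ i → nonzeroPart (a * elem i)) * Product.sum (λ i → atZero a (elem i))
        ≈⟨ Product.∑-distrib-+ (λ i → nonzeroPart (a * elem i)) (λ i → atZero a (elem i)) ⟨
      Product.sum (λ i → nonzeroPart (a * elem i) * atZero a (elem i))
        ≈⟨ Product.sum-cong-≋ (λ i → scale a≉0 (elem i)) ⟩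
      Product.sum (λ i → a * nonzeroPart (elem i))
        ≈⟨ Product.∑-distrib-+ (λ _ → a) (λ i → nonzeroPart (elem i)) ⟩
      Product.sum {k} (λ _ → a) * Product.sum (λ i → nonzeroPart (elem i))
        ≈⟨ *-congʳ (Product.sum-replicate k) ⟩
      a ^ k * Product.sum (λ i → nonzeroPart (elem i))
        ≈⟨ *-comm _ _ ⟩
      Product.sum (λ i → nonzeroPart (elem i)) * a ^ k ∎)
      where open Enumeration E

  -- No element of `P` is zero, so all correction factors in `product-scaling` are trivial.
  lagrange : ∀ {p} {P : Pred Carrier p} {k a} → Enumeration setoid P k → ¬ (a ≈ 0#) →
             PermutationOn setoid P (a *_) → (∀ {x} → x ∈ P → ¬ (x ≈ 0#)) → a ^ k ≈ 1#
  lagrange E a≉0 π P≉0 =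
    trans (sym (product-scaling E a≉0 π)) (Product.sum-zero _ (λ i → atZero-nonzero (P≉0 (Enumeration.elem∈ E i))))

  -- Exactly one listed element is zero, and it contributes the correction factor `a` in
  -- `product-scaling`. Since `k` counts zero as well, the result is `a` and not `1#`.
  fermat : ∀ {p} {P : Pred Carrier p} {k a} → Enumeration setoid P k → 1 ≤ k → 0# ∈ P →
           (¬ (a ≈ 0#) → PermutationOn setoid P (a *_)) → a ^ k ≈ a
  fermat {k = k} {a} E 1≤k 0∈P π with a ≟ 0#
  ... | yes a≈0 = trans (^-congˡ k a≈0) (trans (0^n≈0 1≤k) (sym a≈0))
  ... | no a≉0 = begin
    a ^ k                                  ≈⟨ product-scaling E a≉0 (π a≉0) ⟨
    Product.sum (λ i → atZero a (elem i))  ≈⟨ Product.sum-single _ i₀ (λ i i≢i₀ → atZero-nonzero λ eq →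
                                                i≢i₀ (elem-injective (trans eq (sym (elem-index 0∈P))))) ⟩
    atZero a (elem i₀)                     ≈⟨ atZero-zero (elem-index 0∈P) ⟩
    a                                      ∎
    where
    open Enumeration E
    i₀ = index 0∈P

  x^N≈x : 1 ≤ N → ∀ x → x ^ N ≈ x
  x^N≈x 1≤N x = fermat enumerateAll 1≤N tt (λ x≉0 → *-permutation x≉0 (λ _ → tt) (λ _ → tt))

  private module × = Mult semiring

  -- Translation by 1 permutes the field, so the sum of its elements absorbs N × 1.
  N×1≈0 : N ×.× 1# ≈ 0#
  N×1≈0 = +-cancelˡ (Sum.sum elem) _ _ (begin
    Sum.sum elem + N ×.× 1#               ≈⟨ +-congˡ (Sum.sum-replicate N) ⟨
    Sum.sum elem + Sum.sum {N} (λ _ → 1#) ≈⟨ Sum.∑-distrib-+ elem (λ _ → 1#) ⟨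
    Sum.sum (λ i → elem i + 1#)           ≈⟨ Sum.sum-reindex enumerateAll translation (λ x → x) (λ eq → eq) ⟨
    Sum.sum elem                          ≈⟨ +-identityʳ _ ⟨
    Sum.sum elem + 0#                     ∎)
    where
    open Enumeration enumerateAll
    +-cancelˡ : ∀ x y z → x + y ≈ x + z → y ≈ z
    +-cancelˡ = GroupProperties.∙-cancelˡ +-group
    translation : PermutationOn setoid Everything (_+ 1#)
    translation = record
      { inv = _+ - 1#
      ; cong = +-congʳ
      ; inv-cong = +-congʳ
      ; closed = λ _ → tt
      ; inv∈ = λ _ → tt
      ; φ-inv = λ _ → trans (+-assoc _ _ _) (trans (+-congˡ (-‿inverseˡ 1#)) (+-identityʳ _))
      ; inv-φ = λ _ → trans (+-assoc _ _ _) (trans (+-congˡ (-‿inverseʳ 1#)) (+-identityʳ _))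
      }

  -- If two were nonzero, the factors of two could be cancelled one by one until `1# ≈ 0#` remained.
  2^k×1≈0⇒1+1≈0 : ∀ k → (2 ℕ.^ k) ×.× 1# ≈ 0# → 1# + 1# ≈ 0#
  2^k×1≈0⇒1+1≈0 zero eq = contradiction (trans (sym (+-identityʳ 1#)) eq) 1≉0
  2^k×1≈0⇒1+1≈0 (suc k) eq with (1# + 1#) ≟ 0#
  ... | yes 2≈0 = 2≈0
  ... | no 2≉0 = 2^k×1≈0⇒1+1≈0 k (x*y≈0⇒y≈0 2≉0 (begin
    (1# + 1#) * (2 ℕ.^ k) ×.× 1#        ≈⟨ *-congʳ (+-congˡ (+-identityʳ 1#)) ⟨
    2 ×.× 1# * (2 ℕ.^ k) ×.× 1#         ≈⟨ ×.×1-homo-* 2 (2 ℕ.^ k) ⟨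
    (2 ℕ.^ suc k) ×.× 1#                ≈⟨ eq ⟩
    0#                                  ∎))

  -- Polynomial functions Σ_{i ≤ d} aᵢ xⁱ with a_d = a, in Horner form.
  Polynomial : ℕ → Carrier → (Carrier → Carrier) → Set (c ⊔ ℓ)
  Polynomial zero    a f = ∀ x → f x ≈ a
  Polynomial (suc d) a f = ∃₂ λ g b → Polynomial d a g × (∀ x → f x ≈ x * g x + b)

  polynomial-^ : ∀ d → Polynomial d 1# (_^ d)
  polynomial-^ zero    = λ _ → refl
  polynomial-^ (suc d) = _ , 0# , polynomial-^ d , λ _ → sym (+-identityʳ _)

  polynomial-+ : ∀ d {a b f g} → Polynomial d a f → Polynomial d b g → Polynomial d (a + b) (λ x → f x + g x)
  polynomial-+ zero p q = λ x → +-cong (p x) (q x)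
  polynomial-+ (suc d) (f′ , a′ , p , f≈) (g′ , b′ , q , g≈) =
    _ , a′ + b′ , polynomial-+ d p q , λ x → trans (+-cong (f≈ x) (g≈ x))
      (solve 5 (λ x f a g b → (x :* f :+ a) :+ (x :* g :+ b) := x :* (f :+ g) :+ (a :+ b)) refl x (f′ x) a′ (g′ x) b′)
    where open Solver using (solve; _:=_; _:+_; _:*_)

  polynomial-cong : ∀ d {a f g} → (∀ x → g x ≈ f x) → Polynomial d a f → Polynomial d a g
  polynomial-cong zero g≈f p = λ x → trans (g≈f x) (p x)
  polynomial-cong (suc d) g≈f (f′ , b , p , f≈) = f′ , b , p , λ x → trans (g≈f x) (f≈ x)

  -- The degree is formal and the leading coefficient may be zero. Padding in this way allows
  -- polynomials of different degrees to be added.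
  polynomial-suc : ∀ d {a f} → Polynomial d a f → Polynomial (suc d) 0# f
  polynomial-suc zero {a} p = (λ _ → 0#) , a , (λ _ → refl) ,
    λ x → trans (p x) (sym (trans (+-congʳ (zeroʳ x)) (+-identityˡ a)))
  polynomial-suc (suc d) (g , b , p , f≈) = g , b , polynomial-suc d p , f≈

  polynomial-< : ∀ {d e a f} → d ℕ.<′ e → Polynomial d a f → Polynomial e 0# f
  polynomial-< (ℕ.≤′-reflexive ≡.refl) p = polynomial-suc _ p
  polynomial-< (ℕ.≤′-step d<e) p = polynomial-suc _ (polynomial-< d<e p)

  -- Synthetic division in Horner form: from f = x g + b and g = (x - r) h + g(r) one gets f = (x -
  -- r)(x h + g(r)) + f(r). The quotient keeps the leading coefficient.
  polynomial-divide : ∀ d {a f} → Polynomial (suc d) a f → ∀ r →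
    ∃ λ h → Polynomial d a h × (∀ x → f x ≈ (x - r) * h x + f r)
  polynomial-divide d {a} {f} (g , b , p , f≈) r = go d p
    where
    open Solver using (solve; _:=_; _:+_; _:*_)
    split : ∀ x → (x - r) + r ≈ x
    split x = trans (+-assoc _ _ _) (trans (+-congˡ (-‿inverseˡ r)) (+-identityʳ x))
    go : ∀ d → Polynomial d a g → ∃ λ h → Polynomial d a h × (∀ x → f x ≈ (x - r) * h x + f r)
    go zero p = g , p , λ x → begin
      f x                             ≈⟨ f≈ x ⟩
      x * g x + b                     ≈⟨ +-congʳ (*-congʳ (split x)) ⟨
      ((x - r) + r) * g x + b         ≈⟨ solve 4 (λ e r g b → (e :+ r) :* g :+ b := e :* g :+ (r :* g :+ b)) refl (x - r) r (g x) b ⟩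
      (x - r) * g x + (r * g x + b)   ≈⟨ +-congˡ (+-congʳ (*-congˡ (trans (p x) (sym (p r))))) ⟩
      (x - r) * g x + (r * g r + b)   ≈⟨ +-congˡ (f≈ r) ⟨
      (x - r) * g x + f r             ∎
    go (suc d) p with polynomial-divide d p r
    ... | h , p′ , g≈ = (λ x → x * h x + g r) , (h , g r , p′ , λ _ → refl) , λ x → begin
      f x                                                  ≈⟨ f≈ x ⟩
      x * g x + b                                          ≈⟨ +-congʳ (*-cong (sym (split x)) (g≈ x)) ⟩
      ((x - r) + r) * ((x - r) * h x + g r) + b
        ≈⟨ solve 5 (λ e r h g b → (e :+ r) :* (e :* h :+ g) :+ b := e :* ((e :+ r) :* h :+ g) :+ (r :* g :+ b))
             refl (x - r) r (h x) (g r) b ⟩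
      (x - r) * (((x - r) + r) * h x + g r) + (r * g r + b)
        ≈⟨ +-cong (*-congˡ (+-congʳ (*-congʳ (split x)))) (sym (f≈ r)) ⟩
      (x - r) * (x * h x + g r) + f r                      ∎

  -- Dividing by x - r₀ lowers the degree, keeps the leading coefficient and keeps the other roots,
  -- which are distinct from r₀. After d divisions only the constant `a` is left, with one root
  -- still to spare.
  root-bound : ∀ d {a f} → Polynomial d a f → (r : Fin (suc d) → Carrier) →
               (∀ {i j} → r i ≈ r j → i ≡ j) → (∀ i → f (r i) ≈ 0#) → a ≈ 0#
  root-bound zero p r r-inj root = trans (sym (p (r zero))) (root zero)
  root-bound (suc d) {f = f} p r r-inj root with polynomial-divide d p (r zero)
  ... | h , p′ , f≈ = root-bound d p′ (r ∘ suc) (Fin.suc-injective ∘ r-inj) λ i →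
    x*y≈0⇒y≈0 (λ eq → contradiction (r-inj (GroupProperties.x∙y⁻¹≈ε⇒x≈y +-group _ _ eq)) λ ())
      (begin
        (r (suc i) - r zero) * h (r (suc i))                ≈⟨ +-identityʳ _ ⟨
        (r (suc i) - r zero) * h (r (suc i)) + 0#           ≈⟨ +-congˡ (root zero) ⟨
        (r (suc i) - r zero) * h (r (suc i)) + f (r zero)   ≈⟨ f≈ (r (suc i)) ⟨
        f (r (suc i))                                       ≈⟨ root (suc i) ⟩
        0#                                                  ∎)

-- Power maps with exponent prime to N - 1.

module Powers {c ℓ N} (K : FiniteField c ℓ N) (3≤N : 3 ≤ N) where
  open FiniteField K hiding (zero)
  open FieldProperties K
  open SetoidReasoning setoid

  private
    M = N ∸ 1
    N≡1+M : N ≡ suc M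
    N≡1+M = ≡.sym (ℕ.m+[n∸m]≡n (ℕ.≤-trans (s≤s z≤n) 3≤N))
    M≡1+[N∸2] : M ≡ suc (N ∸ 2)
    M≡1+[N∸2] = ≡.trans (≡.sym (ℕ.m+[n∸m]≡n {1} {M} (ℕ.∸-monoˡ-≤ 1 (ℕ.≤-trans (ℕ.n≤1+n 2) 3≤N)))) (≡.cong suc (ℕ.∸-+-assoc N 1 1))

  x^[N-1]≈1 : ∀ {x} → ¬ (x ≈ 0#) → x ^ (N ∸ 1) ≈ 1#
  x^[N-1]≈1 {x} x≉0 = *-cancelˡ x≉0 (begin
    x ^ suc M  ≈⟨ ^-congʳ x N≡1+M ⟨
    x ^ N      ≈⟨ x^N≈x (ℕ.≤-trans (s≤s z≤n) 3≤N) x ⟩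
    x          ≈⟨ *-identityʳ x ⟨
    x * 1#     ∎)

  -- This makes inversion a power map with natural exponent. It holds at zero too, by the convention
  -- 0⁻¹ = 0 and because N - 2 is positive.
  x^[N-2]≈x⁻¹ : ∀ x → x ^ (N ∸ 2) ≈ x ⁻¹
  x^[N-2]≈x⁻¹ x with x ≟ 0#
  ... | yes x≈0 = trans (^-congˡ (N ∸ 2) x≈0) (0^n≈0 (ℕ.∸-monoˡ-≤ 2 3≤N))
  ... | no x≉0 = *-cancelˡ x≉0 (begin
    x ^ suc (N ∸ 2)           ≈⟨ ^-congʳ x M≡1+[N∸2] ⟨
    x ^ M                     ≈⟨ x^[N-1]≈1 x≉0 ⟩
    1#                        ≈⟨ proj₂ (inverse x x≉0) ⟨
    x * proj₁ (inverse x x≉0) ∎)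

  ⁻¹-involutive₀ : ∀ x → x ⁻¹ ⁻¹ ≈ x
  ⁻¹-involutive₀ x = go (x ≟ 0#)
    where
    go : Dec (x ≈ 0#) → x ⁻¹ ⁻¹ ≈ x
    go (yes x≈0) = trans (x≈0⇒x⁻¹≈0 (x≈0⇒x⁻¹≈0 x≈0)) (sym x≈0)
    go (no x≉0) = ⁻¹-involutive x≉0

  -- The exponent `k′` is an inverse of `k` modulo M = N - 1, read off from a Bézout relation. The
  -- two orientations of the relation give k a ≡ 1 and k a ≡ -1.
  power-root : ∀ k → Coprime k (N ∸ 1) → ∃ λ k′ → ∀ x → (x ^ k) ^ k′ ≈ x
  power-root k coprime with coprime-Bézout coprime
  ... | Bézout.+- a b 1+bM≡ak = a , root
    where
    root : ∀ x → (x ^ k) ^ a ≈ x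
    root x = begin
      (x ^ k) ^ a       ≈⟨ ^-assocʳ x k a ⟩
      x ^ (k ℕ.* a)     ≈⟨ ^-congʳ x (≡.trans (ℕ.*-comm k a) (≡.trans (≡.sym 1+bM≡ak) (≡.cong suc (ℕ.*-comm b M)))) ⟩
      x * x ^ (M ℕ.* b) ≈⟨ cancel (x ≟ 0#) ⟩
      x                 ∎
      where
      cancel : Dec (x ≈ 0#) → x * x ^ (M ℕ.* b) ≈ x
      cancel (yes x≈0) = trans (*-congʳ x≈0) (trans (zeroˡ _) (sym x≈0))
      cancel (no x≉0)  = begin
        x * x ^ (M ℕ.* b) ≈⟨ *-congˡ (^-assocʳ x M b) ⟨
        x * (x ^ M) ^ b   ≈⟨ *-congˡ (^-congˡ b (x^[N-1]≈1 x≉0)) ⟩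
        x * 1# ^ b        ≈⟨ *-congˡ (1^n≈1 b) ⟩
        x * 1#            ≈⟨ *-identityʳ x ⟩
        x                 ∎
  -- Now the inverse exponent is -a, and the factor N - 2 supplies the sign. Adding `M` changes
  -- nothing at nonzero elements and makes the exponent visibly positive, so that zero is sent to
  -- zero.
  ... | Bézout.-+ a b 1+ak≡bM = a ℕ.* (N ∸ 2) ℕ.+ M , λ x → root x (x ≟ 0#)
    where
    1≤M : 1 ≤ M
    1≤M = ≡.subst (1 ≤_) (≡.sym M≡1+[N∸2]) (s≤s z≤n)
    -- Zero is coprime to `M` only when `M` is one, while here `M` is at least two.
    1≤k : 1 ≤ k
    1≤k = ℕ.n≢0⇒n>0 λ k≡0 → ℕ.<⇒≢ (ℕ.∸-monoˡ-≤ 1 3≤N)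
      (≡.sym (0-coprimeTo-m⇒m≡1 (≡.subst (λ k → Coprime k M) k≡0 coprime)))
    root : ∀ x → Dec (x ≈ 0#) → (x ^ k) ^ (a ℕ.* (N ∸ 2) ℕ.+ M) ≈ x
    root x (yes x≈0) = begin
      (x ^ k) ^ (a ℕ.* (N ∸ 2) ℕ.+ M)  ≈⟨ ^-congˡ (a ℕ.* (N ∸ 2) ℕ.+ M) (trans (^-congˡ k x≈0) (0^n≈0 1≤k)) ⟩
      0# ^ (a ℕ.* (N ∸ 2) ℕ.+ M)       ≈⟨ 0^n≈0 (ℕ.≤-trans 1≤M (ℕ.m≤n+m M (a ℕ.* (N ∸ 2)))) ⟩
      0#                               ≈⟨ x≈0 ⟨
      x                                ∎
    root x (no x≉0) = begin
      y ^ (a ℕ.* (N ∸ 2) ℕ.+ M)        ≈⟨ ^-homo-* y (a ℕ.* (N ∸ 2)) M ⟩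
      y ^ (a ℕ.* (N ∸ 2)) * y ^ M      ≈⟨ *-congˡ (x^[N-1]≈1 (^-nonzero k x≉0)) ⟩
      y ^ (a ℕ.* (N ∸ 2)) * 1#         ≈⟨ *-identityʳ _ ⟩
      y ^ (a ℕ.* (N ∸ 2))              ≈⟨ ^-assocʳ y a (N ∸ 2) ⟨
      (y ^ a) ^ (N ∸ 2)                ≈⟨ x^[N-2]≈x⁻¹ (y ^ a) ⟩
      (y ^ a) ⁻¹                       ≈⟨ ⁻¹-cong (⁻¹-unique x*y^a≈1) ⟩
      x ⁻¹ ⁻¹                          ≈⟨ ⁻¹-involutive x≉0 ⟩
      x                                ∎
      where
      y = x ^ k
      x*y^a≈1 : x * y ^ a ≈ 1#
      x*y^a≈1 = begin
        x * y ^ a         ≈⟨ *-congˡ (^-assocʳ x k a) ⟩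
        x ^ suc (k ℕ.* a) ≈⟨ ^-congʳ x (≡.trans (≡.cong suc (ℕ.*-comm k a)) (≡.trans 1+ak≡bM (ℕ.*-comm b M))) ⟩
        x ^ (M ℕ.* b)     ≈⟨ ^-assocʳ x M b ⟨
        (x ^ M) ^ b       ≈⟨ ^-congˡ b (x^[N-1]≈1 x≉0) ⟩
        1# ^ b            ≈⟨ 1^n≈1 b ⟩
        1#                ∎

  -- The integer gcd sees only the absolute value of `t`. A negative exponent is its absolute value
  -- preceded by inversion, which is the power N - 2 and is undone by applying it again.
  ^ℤ-permutation : ∀ t → ℤ.gcd t (+ (N ∸ 1)) ≡ 1ℤ →
    ∃₂ λ k k′ → (∀ x → x ^ℤ t ≈ x ^ k) × (∀ x → (x ^ k) ^ k′ ≈ x)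
  ^ℤ-permutation (+ k) gcd≡1 with power-root k (gcd≡1⇒coprime (ℤ.+-injective gcd≡1))
  ... | k′ , root = k , k′ , (λ _ → refl) , root
  ^ℤ-permutation -[1+ k ] gcd≡1 with power-root (suc k) (gcd≡1⇒coprime (ℤ.+-injective gcd≡1))
  ... | k′ , root = (N ∸ 2) ℕ.* suc k , k′ ℕ.* (N ∸ 2) , power , λ x → begin
    (x ^ ((N ∸ 2) ℕ.* suc k)) ^ (k′ ℕ.* (N ∸ 2)) ≈⟨ ^-congˡ (k′ ℕ.* (N ∸ 2)) (power x) ⟨
    ((x ⁻¹) ^ suc k) ^ (k′ ℕ.* (N ∸ 2))          ≈⟨ ^-assocʳ _ k′ (N ∸ 2) ⟨
    (((x ⁻¹) ^ suc k) ^ k′) ^ (N ∸ 2)            ≈⟨ ^-congˡ (N ∸ 2) (root (x ⁻¹)) ⟩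
    (x ⁻¹) ^ (N ∸ 2)                             ≈⟨ x^[N-2]≈x⁻¹ (x ⁻¹) ⟩
    x ⁻¹ ⁻¹                                      ≈⟨ ⁻¹-involutive₀ x ⟩
    x                                            ∎
    where
    power : ∀ x → (x ⁻¹) ^ suc k ≈ x ^ ((N ∸ 2) ℕ.* suc k)
    power x = begin
      (x ⁻¹) ^ suc k           ≈⟨ ^-congˡ (suc k) (x^[N-2]≈x⁻¹ x) ⟨
      (x ^ (N ∸ 2)) ^ suc k    ≈⟨ ^-assocʳ x (N ∸ 2) (suc k) ⟩
      x ^ ((N ∸ 2) ℕ.* suc k)  ∎

-- Characteristic two: Frobenius, absolute trace and signs.

module CharacteristicTwo {c ℓ N} (K : FiniteField c ℓ N)
  (1+1≈0 : FiniteField._≈_ K (FiniteField._+_ K (FiniteField.1# K) (FiniteField.1# K)) (FiniteField.0# K)) where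
  open FiniteField K hiding (zero)
  open FieldProperties K
  open SetoidReasoning setoid
  private
    module Solver = SemiringSolver commutativeSemiring
    module Sum = Sums +-commutativeMonoid

  x+x≈0 : ∀ x → x + x ≈ 0#
  x+x≈0 x = begin
    x + x             ≈⟨ +-cong (*-identityʳ x) (*-identityʳ x) ⟨
    x * 1# + x * 1#   ≈⟨ distribˡ x 1# 1# ⟨
    x * (1# + 1#)     ≈⟨ *-congˡ 1+1≈0 ⟩
    x * 0#            ≈⟨ zeroʳ x ⟩
    0#                ∎

  x+[x+y]≈y : ∀ x y → x + (x + y) ≈ y
  x+[x+y]≈y x y = trans (sym (+-assoc x x y)) (trans (+-congʳ (x+x≈0 x)) (+-identityˡ y))

  x+y+y≈x : ∀ x y → x + y + y ≈ x
  x+y+y≈x x y = trans (+-assoc x y y) (trans (+-congˡ (x+x≈0 y)) (+-identityʳ x))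

  x+y≈0⇒x≈y : ∀ {x y} → x + y ≈ 0# → x ≈ y
  x+y≈0⇒x≈y {x} {y} eq = begin
    x             ≈⟨ +-identityʳ x ⟨
    x + 0#        ≈⟨ +-congˡ eq ⟨
    x + (x + y)   ≈⟨ x+[x+y]≈y x y ⟩
    y             ∎

  square : ∀ x → x ^ 2 ≈ x * x
  square x = *-congˡ (*-identityʳ x)

  frobenius-+ : ∀ k x y → (x + y) ^ (2 ℕ.^ k) ≈ x ^ (2 ℕ.^ k) + y ^ (2 ℕ.^ k)
  frobenius-+ zero x y = trans (*-identityʳ _) (sym (+-cong (*-identityʳ x) (*-identityʳ y)))
  frobenius-+ (suc k) x y = begin
    (x + y) ^ (2 ℕ.* 2 ℕ.^ k)                       ≈⟨ ^-assocʳ (x + y) 2 (2 ℕ.^ k) ⟨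
    ((x + y) ^ 2) ^ (2 ℕ.^ k)                       ≈⟨ ^-congˡ (2 ℕ.^ k) square-+ ⟩
    (x ^ 2 + y ^ 2) ^ (2 ℕ.^ k)                     ≈⟨ frobenius-+ k (x ^ 2) (y ^ 2) ⟩
    (x ^ 2) ^ (2 ℕ.^ k) + (y ^ 2) ^ (2 ℕ.^ k)       ≈⟨ +-cong (^-assocʳ x 2 (2 ℕ.^ k)) (^-assocʳ y 2 (2 ℕ.^ k)) ⟩
    x ^ (2 ℕ.* 2 ℕ.^ k) + y ^ (2 ℕ.* 2 ℕ.^ k)       ∎
    where
    open Solver using (solve; _:=_; _:+_; _:*_)
    square-+ : (x + y) ^ 2 ≈ x ^ 2 + y ^ 2
    square-+ = begin
      (x + y) ^ 2                      ≈⟨ square _ ⟩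
      (x + y) * (x + y)                ≈⟨ solve 2 (λ x y → (x :+ y) :* (x :+ y) := (x :* x :+ y :* y) :+ (x :* y :+ x :* y)) refl x y ⟩
      (x * x + y * y) + (x * y + x * y) ≈⟨ +-congˡ (x+x≈0 (x * y)) ⟩
      (x * x + y * y) + 0#             ≈⟨ +-identityʳ _ ⟩
      x * x + y * y                    ≈⟨ +-cong (square x) (square y) ⟨
      x ^ 2 + y ^ 2                    ∎

  absTrace-cong : ∀ k → Congruent _≈_ _≈_ (absTrace k)
  absTrace-cong k x≈y = Sum.sum-cong-≋ {k} (λ i → ^-congˡ (2 ℕ.^ toℕ i) x≈y)

  absTrace-+ : ∀ k x y → absTrace k (x + y) ≈ absTrace k x + absTrace k y
  absTrace-+ k x y = trans (Sum.sum-cong-≋ {k} (λ i → frobenius-+ (toℕ i) x y))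
    (Sum.∑-distrib-+ {k} (λ i → x ^ (2 ℕ.^ toℕ i)) (λ i → y ^ (2 ℕ.^ toℕ i)))

  absTrace-0 : ∀ k → absTrace k 0# ≈ 0#
  absTrace-0 k = Sum.sum-zero {k} _ (λ i → 0^n≈0 (ℕ.m^n>0 2 (toℕ i)))

  absTrace-suc : ∀ k y → absTrace (suc k) y ≈ y + absTrace k (y ^ 2)
  absTrace-suc k y = +-cong (*-identityʳ y) (Sum.sum-cong-≋ {k} (λ i → sym (^-assocʳ y 2 (2 ℕ.^ toℕ i))))

  -- Used with k = 1 to isolate the last summand, and with both lengths equal to m for the
  -- transitivity of the trace.
  absTrace-split : ∀ j k y → absTrace (j ℕ.+ k) y ≈ absTrace j y + absTrace k (y ^ (2 ℕ.^ j))
  absTrace-split zero k y = trans (absTrace-cong k (sym (*-identityʳ y))) (sym (+-identityˡ _))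
  absTrace-split (suc j) k y = begin
    absTrace (suc (j ℕ.+ k)) y                                      ≈⟨ absTrace-suc (j ℕ.+ k) y ⟩
    y + absTrace (j ℕ.+ k) (y ^ 2)                                  ≈⟨ +-congˡ (absTrace-split j k (y ^ 2)) ⟩
    y + (absTrace j (y ^ 2) + absTrace k ((y ^ 2) ^ (2 ℕ.^ j)))     ≈⟨ +-assoc _ _ _ ⟨
    y + absTrace j (y ^ 2) + absTrace k ((y ^ 2) ^ (2 ℕ.^ j))
      ≈⟨ +-cong (sym (absTrace-suc j y)) (absTrace-cong k (^-assocʳ y 2 (2 ℕ.^ j))) ⟩
    absTrace (suc j) y + absTrace k (y ^ (2 ℕ.* 2 ℕ.^ j))           ∎

  absTrace-last : ∀ k y → absTrace (suc k) y ≈ absTrace k y + y ^ (2 ℕ.^ k)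
  absTrace-last k y = begin
    absTrace (suc k) y                            ≡⟨ ≡.cong (λ j → absTrace j y) (ℕ.+-comm 1 k) ⟩
    absTrace (k ℕ.+ 1) y                          ≈⟨ absTrace-split k 1 y ⟩
    absTrace k y + absTrace 1 (y ^ (2 ℕ.^ k))     ≈⟨ +-congˡ (trans (+-identityʳ _) (*-identityʳ _)) ⟩
    absTrace k y + y ^ (2 ℕ.^ k)                  ∎

  absTrace-square : ∀ k y → absTrace k (y ^ 2) ≈ absTrace k y ^ 2
  absTrace-square zero y = sym (0^n≈0 (s≤s (z≤n {1})))
  absTrace-square (suc k) y = begin
    absTrace (suc k) (y ^ 2)              ≈⟨ absTrace-suc k (y ^ 2) ⟩
    y ^ 2 + absTrace k ((y ^ 2) ^ 2)      ≈⟨ +-congˡ (absTrace-square k (y ^ 2)) ⟩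
    y ^ 2 + absTrace k (y ^ 2) ^ 2        ≈⟨ frobenius-+ 1 y (absTrace k (y ^ 2)) ⟨
    (y + absTrace k (y ^ 2)) ^ 2          ≈⟨ ^-congˡ 2 (absTrace-suc k y) ⟨
    absTrace (suc k) y ^ 2                ∎

  Bit : Pred Carrier ℓ
  Bit x = x ≈ 0# ⊎ x ≈ 1#

  -- Squaring shifts the summands cyclically when y^(2ᵏ) = y, so the trace is its own square, and a
  -- field has no idempotents besides zero and one.
  absTrace-bit : ∀ k {y} → y ^ (2 ℕ.^ k) ≈ y → Bit (absTrace k y)
  absTrace-bit k {y} y^2^k≈y = idempotent (absTrace k y ≟ 0#)
    where
    t² : absTrace k y * absTrace k y ≈ absTrace k y
    t² = begin
      absTrace k y * absTrace k y           ≈⟨ square _ ⟨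
      absTrace k y ^ 2                      ≈⟨ absTrace-square k y ⟨
      absTrace k (y ^ 2)                    ≈⟨ x+[x+y]≈y y _ ⟨
      y + (y + absTrace k (y ^ 2))          ≈⟨ +-congˡ (absTrace-suc k y) ⟨
      y + absTrace (suc k) y                ≈⟨ +-congˡ (absTrace-last k y) ⟩
      y + (absTrace k y + y ^ (2 ℕ.^ k))    ≈⟨ +-congˡ (trans (+-congˡ y^2^k≈y) (+-comm _ y)) ⟩
      y + (y + absTrace k y)                ≈⟨ x+[x+y]≈y y _ ⟩
      absTrace k y                          ∎
    idempotent : Dec (absTrace k y ≈ 0#) → Bit (absTrace k y)
    idempotent (yes t≈0) = inj₁ t≈0
    idempotent (no t≉0)  = inj₂ (*-cancelˡ t≉0 (trans t² (sym (*-identityʳ _))))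

  -- The last summand alone reaches degree 2ᵏ; the earlier ones are padded with a zero leading
  -- coefficient.
  absTrace-polynomial : ∀ k → Polynomial (2 ℕ.^ k) 1# (absTrace (suc k))
  absTrace-polynomial zero = polynomial-cong 1 (λ x → +-identityʳ (x ^ 1)) (polynomial-^ 1)
  absTrace-polynomial (suc k) with polynomial-+ (2 ℕ.^ suc k)
      (polynomial-< (ℕ.≤⇒≤′ (ℕ.^-monoʳ-< 2 (s≤s (s≤s z≤n)) (ℕ.n<1+n k))) (absTrace-polynomial k))
      (polynomial-^ (2 ℕ.^ suc k))
  ... | p = polynomial-cong (2 ℕ.^ suc k) (absTrace-last (suc k)) (leading (2 ℕ.^ suc k) (+-identityˡ 1#) p)
    where
    leading : ∀ d {a b f} → a ≈ b → Polynomial d a f → Polynomial d b f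
    leading zero a≈b p = λ x → trans (p x) a≈b
    leading (suc d) a≈b (g , b , p , f≈) = g , b , leading d a≈b p , f≈

  -- The polynomial x + x² + ⋯ + x^(2^(k−1)) has degree below 2ᵏ.
  absTrace-nontrivial : ∀ {p} {P : Pred Carrier p} k → 1 ≤ k → Enumeration setoid P (2 ℕ.^ k) →
                        ∃ λ y → y ∈ P × ¬ (absTrace k y ≈ 0#)
  absTrace-nontrivial (suc k) _ E with Fin.all? (λ i → absTrace (suc k) (Enumeration.elem E i) ≟ 0#)
  ... | no ¬all with Fin.¬∀⟶∃¬ _ _ (λ i → absTrace (suc k) (Enumeration.elem E i) ≟ 0#) ¬all
  ...   | i , ≉0 = Enumeration.elem E i , Enumeration.elem∈ E i , ≉0
  absTrace-nontrivial (suc k) _ E | yes all = contradiction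
    (root-bound (2 ℕ.^ k) (absTrace-polynomial k) (λ i → elem (inject≤ i bound))
      (λ {i} {j} eq → Fin.inject≤-injective bound bound i j (elem-injective eq))
      (λ i → all (inject≤ i bound)))
    1≉0
    where
    open Enumeration E
    bound : suc (2 ℕ.^ k) ≤ 2 ℕ.^ suc k
    bound = ℕ.^-monoʳ-< 2 (s≤s (s≤s z≤n)) (ℕ.n<1+n k)

  sign-0 : ∀ {x} → x ≈ 0# → sign x ≡ 1ℤ
  sign-0 {x} x≈0 = ≡.cong (if_then 1ℤ else -1ℤ) (dec-true (x ≟ 0#) x≈0)

  sign-nonzero : ∀ {x} → ¬ (x ≈ 0#) → sign x ≡ -1ℤ
  sign-nonzero {x} x≉0 = ≡.cong (if_then 1ℤ else -1ℤ) (dec-false (x ≟ 0#) x≉0)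

  sign-cong : Congruent _≈_ _≡_ sign
  sign-cong {x} {y} x≈y = go (y ≟ 0#)
    where
    go : Dec (y ≈ 0#) → sign x ≡ sign y
    go (yes y≈0) = ≡.trans (sign-0 (trans x≈y y≈0)) (≡.sym (sign-0 y≈0))
    go (no y≉0)  = ≡.trans (sign-nonzero (λ x≈0 → y≉0 (trans (sym x≈y) x≈0))) (≡.sym (sign-nonzero y≉0))

  sign-±1 : ∀ x → sign x ≡ 1ℤ ⊎ sign x ≡ -1ℤ
  sign-±1 x = go (x ≟ 0#)
    where
    go : Dec (x ≈ 0#) → sign x ≡ 1ℤ ⊎ sign x ≡ -1ℤ
    go (yes x≈0) = inj₁ (sign-0 x≈0)
    go (no x≉0)  = inj₂ (sign-nonzero x≉0)

  -- `sign` is -1 at every nonzero element of the field, so multiplicativity is asserted on the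
  -- prime field, where 1 + 1 = 0 is the one case to compute.
  sign-+ : ∀ {x y} → Bit x → Bit y → sign (x + y) ≡ sign x ℤ.* sign y
  sign-+ {x} {y} (inj₁ x≈0) _ = ≡.trans (sign-cong (trans (+-congʳ x≈0) (+-identityˡ y)))
    (≡.sym (≡.trans (≡.cong (ℤ._* sign y) (sign-0 x≈0)) (ℤ.*-identityˡ _)))
  sign-+ {x} {y} (inj₂ _) (inj₁ y≈0) = ≡.trans (sign-cong (trans (+-congˡ y≈0) (+-identityʳ x)))
    (≡.sym (≡.trans (≡.cong (sign x ℤ.*_) (sign-0 y≈0)) (ℤ.*-identityʳ _)))
  sign-+ {x} {y} (inj₂ x≈1) (inj₂ y≈1) = ≡.trans (sign-0 (trans (+-cong x≈1 y≈1) 1+1≈0))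
    (≡.sym (≡.cong₂ ℤ._*_ (sign-nonzero (λ x≈0 → 1≉0 (trans (sym x≈1) x≈0)))
                          (sign-nonzero (λ y≈0 → 1≉0 (trans (sym y≈1) y≈0)))))

private
  module Σℤ where
    open Sums ℤ.+-0-commutativeMonoid public
    open SemiringSum ℤ.+-*-semiring public using (*-distribˡ-sum)

sum-const : ∀ k x → Σℤ.sum {k} (λ _ → x) ≡ + k ℤ.* x
sum-const zero x = ≡.refl
sum-const (suc k) x = ≡.trans (≡.cong (λ y → x ℤ.+ y) (sum-const k x)) (≡.sym (ℤ.suc-* (+ k) x))

-- The quadratic extension of 𝔽_q and the closed form of `T`.

module QuadraticExtension {c ℓ} (m : ℕ) (2≤m : 2 ≤ m) (K : FiniteField c ℓ (2 ℕ.^ (2 ℕ.* m))) where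
  open FiniteField K hiding (zero)
  open HyperBentness m K
  open FieldProperties K
  open SetoidReasoning setoid
  private
    module Solver = SemiringSolver commutativeSemiring
    module Sum = Sums +-commutativeMonoid
    module × = Mult semiring

  -- The order of `K` is a power of two and annihilates `1#`, which forces characteristic two.
  open CharacteristicTwo K (2^k×1≈0⇒1+1≈0 (2 ℕ.* m) N×1≈0) public

  q h : ℕ
  q = 2 ℕ.^ m
  h = 2 ℕ.^ (m ∸ 1)

  q≡1+[q∸1] : q ≡ suc (q ∸ 1)
  q≡1+[q∸1] = ≡.sym (ℕ.m+[n∸m]≡n (ℕ.m^n>0 2 m))

  q≡2*h : q ≡ 2 ℕ.* h
  q≡2*h = ≡.cong (2 ℕ.^_) (≡.sym (ℕ.m+[n∸m]≡n (ℕ.≤-trans (s≤s z≤n) 2≤m)))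

  4≤q : 4 ≤ q
  4≤q = ℕ.^-monoʳ-≤ 2 2≤m

  x^|K|≈x : ∀ x → x ^ (2 ℕ.^ n) ≈ x
  x^|K|≈x = x^N≈x (ℕ.m^n>0 2 n)

  x^q^q≈x : ∀ x → (x ^ q) ^ q ≈ x
  x^q^q≈x x = begin
    (x ^ q) ^ q      ≈⟨ ^-assocʳ x q q ⟩
    x ^ (q ℕ.* q)    ≈⟨ ^-congʳ x (≡.trans (≡.sym (ℕ.^-distribˡ-+-* 2 m m)) (≡.cong (λ k → 2 ℕ.^ (m ℕ.+ k)) (≡.sym (ℕ.+-identityʳ m)))) ⟩
    x ^ (2 ℕ.^ n)    ≈⟨ x^|K|≈x x ⟩
    x                ∎

  -- The subfield 𝔽_q, as the fixed points of x ↦ x^q.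
  Fixed : Pred Carrier ℓ
  Fixed x = x ^ q ≈ x

  fixed? : ∀ x → Dec (Fixed x)
  fixed? x = (x ^ q) ≟ x

  fixed-0 : Fixed 0#
  fixed-0 = 0^n≈0 (ℕ.m^n>0 2 m)

  fixed-+ : ∀ {x y} → Fixed x → Fixed y → Fixed (x + y)
  fixed-+ {x} {y} fx fy = trans (frobenius-+ m x y) (+-cong fx fy)

  fixed-* : ∀ {x y} → Fixed x → Fixed y → Fixed (x * y)
  fixed-* {x} {y} fx fy = trans (^-distrib-* x y q) (*-cong fx fy)

  ^-comm : ∀ x j k → (x ^ j) ^ k ≈ (x ^ k) ^ j
  ^-comm x j k = trans (^-assocʳ x j k) (trans (^-congʳ x (ℕ.*-comm j k)) (sym (^-assocʳ x k j)))

  fixed-^ : ∀ k {x} → Fixed x → Fixed (x ^ k)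
  fixed-^ k {x} fx = trans (^-comm x k q) (^-congˡ k fx)

  fixed-resp : ∀ {x y} → x ≈ y → Fixed x → Fixed y
  fixed-resp x≈y fx = trans (^-congˡ q (sym x≈y)) (trans fx x≈y)

  fixed-⁻¹ : ∀ {x} → Fixed x → Fixed (x ⁻¹)
  fixed-⁻¹ {x} fx = go (x ≟ 0#)
    where
    go : Dec (x ≈ 0#) → Fixed (x ⁻¹)
    go (yes x≈0) = fixed-resp (sym (x≈0⇒x⁻¹≈0 x≈0)) fixed-0
    go (no x≉0) = ⁻¹-unique (begin
      x * (x ⁻¹) ^ q      ≈⟨ *-congʳ fx ⟨
      x ^ q * (x ⁻¹) ^ q  ≈⟨ ^-distrib-* x (x ⁻¹) q ⟨
      (x * x ⁻¹) ^ q      ≈⟨ ^-congˡ q (⁻¹-inverseʳ x≉0) ⟩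
      1# ^ q              ≈⟨ 1^n≈1 q ⟩
      1#                  ∎)

  fixed⇒x^[q-1]≈1 : ∀ {x} → Fixed x → ¬ (x ≈ 0#) → x ^ (q ∸ 1) ≈ 1#
  fixed⇒x^[q-1]≈1 {x} fx x≉0 = *-cancelˡ x≉0 (begin
    x ^ suc (q ∸ 1) ≈⟨ ^-congʳ x q≡1+[q∸1] ⟨
    x ^ q           ≈⟨ fx ⟩
    x               ≈⟨ *-identityʳ x ⟨
    x * 1#          ∎)

  relTrace-cong : Congruent _≈_ _≈_ relTrace
  relTrace-cong x≈y = +-cong x≈y (^-congˡ q x≈y)

  relTrace-fixed : ∀ x → Fixed (relTrace x)
  relTrace-fixed x = begin
    (x + x ^ q) ^ q       ≈⟨ frobenius-+ m x (x ^ q) ⟩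
    x ^ q + (x ^ q) ^ q   ≈⟨ +-congˡ (x^q^q≈x x) ⟩
    x ^ q + x             ≈⟨ +-comm _ _ ⟩
    x + x ^ q             ∎

  relTrace-+ : ∀ x y → relTrace (x + y) ≈ relTrace x + relTrace y
  relTrace-+ x y = begin
    x + y + (x + y) ^ q       ≈⟨ +-congˡ (frobenius-+ m x y) ⟩
    x + y + (x ^ q + y ^ q)   ≈⟨ solve 4 (λ a b c d → (a :+ b) :+ (c :+ d) := (a :+ c) :+ (b :+ d)) refl x y (x ^ q) (y ^ q) ⟩
    relTrace x + relTrace y   ∎
    where open Solver using (solve; _:=_; _:+_)

  relTrace-scale : ∀ {y} → Fixed y → ∀ x → relTrace (y * x) ≈ y * relTrace x
  relTrace-scale {y} fy x = begin
    y * x + (y * x) ^ q      ≈⟨ +-congˡ (trans (^-distrib-* y x q) (*-congʳ fy)) ⟩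
    y * x + y * x ^ q        ≈⟨ distribˡ y x (x ^ q) ⟨
    y * relTrace x           ∎

  fixed⇒relTrace≈0 : ∀ {x} → Fixed x → relTrace x ≈ 0#
  fixed⇒relTrace≈0 {x} fx = trans (+-congˡ fx) (x+x≈0 x)

  relTrace≈0⇒fixed : ∀ {x} → relTrace x ≈ 0# → Fixed x
  relTrace≈0⇒fixed eq = sym (x+y≈0⇒x≈y eq)

  -- Transitivity of the trace: the last m conjugates of `x` are the first m conjugates of x^q.
  absTrace-tower : ∀ x → absTrace n x ≈ absTrace m (relTrace x)
  absTrace-tower x = begin
    absTrace (m ℕ.+ (m ℕ.+ 0)) x                 ≈⟨ absTrace-split m (m ℕ.+ 0) x ⟩
    absTrace m x + absTrace (m ℕ.+ 0) (x ^ q)    ≡⟨ ≡.cong (λ k → absTrace m x + absTrace k (x ^ q)) (ℕ.+-identityʳ m) ⟩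
    absTrace m x + absTrace m (x ^ q)            ≈⟨ absTrace-+ m x (x ^ q) ⟨
    absTrace m (relTrace x)                      ∎

  -- The telescoping identity, with signs immaterial in characteristic two. It is not divided by 1 +
  -- w, so it covers w = 1.
  geometric : ∀ k w → (1# + w) * sum {k} (λ j → w ^ suc (toℕ j)) ≈ w + w ^ suc k
  geometric zero w = begin
    (1# + w) * 0#  ≈⟨ zeroʳ _ ⟩
    0#             ≈⟨ x+x≈0 w ⟨
    w + w          ≈⟨ +-congˡ (*-identityʳ w) ⟨
    w + w ^ 1      ∎
  geometric (suc k) w = begin
    (1# + w) * (w ^ 1 + sum {k} (λ j → w * w ^ suc (toℕ j)))
      ≈⟨ *-congˡ (+-cong (*-identityʳ w) (sym (SemiringSum.*-distribˡ-sum semiring {k} w (λ j → w ^ suc (toℕ j))))) ⟩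
    (1# + w) * (w + w * s)
      ≈⟨ solve 2 (λ w s → (con 1 :+ w) :* (w :+ w :* s) := (w :+ w :* w) :+ w :* ((con 1 :+ w) :* s)) refl w s ⟩
    w + w * w + w * ((1# + w) * s)
      ≈⟨ +-congˡ (*-congˡ (geometric k w)) ⟩
    w + w * w + w * (w + w ^ suc k)
      ≈⟨ solve 2 (λ w p → (w :+ w :* w) :+ w :* (w :+ p) := (w :+ w :* p) :+ (w :* w :+ w :* w)) refl w (w ^ suc k) ⟩
    w + w ^ suc (suc k) + (w * w + w * w)
      ≈⟨ trans (+-congˡ (x+x≈0 (w * w))) (+-identityʳ _) ⟩
    w + w ^ suc (suc k) ∎
    where
    open Solver using (solve; _:=_; _:+_; _:*_; con)
    s = sum {k} (λ j → w ^ suc (toℕ j))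

  -- The number `h` of summands in `T` is even because m ≥ 2. For m = 1 there is a single summand
  -- and the closed form already fails at z = 1.
  h×1≈0 : h ×.× 1# ≈ 0#
  h×1≈0 = begin
    h ×.× 1#                               ≈⟨ ×.×-congˡ h≡ ⟩
    (2 ℕ.* 2 ℕ.^ (m ∸ 2)) ×.× 1#           ≈⟨ ×.×1-homo-* 2 (2 ℕ.^ (m ∸ 2)) ⟩
    2 ×.× 1# * (2 ℕ.^ (m ∸ 2)) ×.× 1#      ≈⟨ *-congʳ (trans (+-congˡ (+-identityʳ 1#)) (x+x≈0 1#)) ⟩
    0# * (2 ℕ.^ (m ∸ 2)) ×.× 1#            ≈⟨ zeroˡ _ ⟩
    0#                                     ∎
    where
    h≡ : h ≡ 2 ℕ.* 2 ℕ.^ (m ∸ 2)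
    h≡ = ≡.cong (2 ℕ.^_) (≡.trans (≡.sym (ℕ.m+[n∸m]≡n {1} (ℕ.∸-monoˡ-≤ 1 2≤m))) (≡.cong suc (ℕ.∸-+-assoc m 1 1)))

  powerSum : Carrier → Carrier
  powerSum x = sum {h} (λ j → x ^ (suc (toℕ j) ℕ.* (q ∸ 1)))

  powerSum-cong : Congruent _≈_ _≈_ powerSum
  powerSum-cong x≈y = Sum.sum-cong-≋ {h} (λ j → ^-congˡ (suc (toℕ j) ℕ.* (q ∸ 1)) x≈y)

  -- With w = z^(2(q-1)) one has z² w = z̄², hence z² (1 + w) = τ². Squaring the argument turns the
  -- exponent h into 2h = q, hence z̄ w^h = z. The geometric sum then gives τ² S = z̄² + z̄ z = τ
  -- z̄.
  powerSum-square : ∀ z → powerSum (z ^ 2) ≈ z ^ q * relTrace z ⁻¹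
  powerSum-square z = trans (Sum.sum-cong-≋ {h} regroup) (evaluate (τ ≟ 0#))
    where
    open Solver using (solve; _:=_; _:+_; _:*_; con)
    w τ z̄ S : Carrier
    w = (z ^ 2) ^ (q ∸ 1)
    τ = relTrace z
    z̄ = z ^ q
    S = sum {h} (λ j → w ^ suc (toℕ j))
    regroup : ∀ (j : Fin h) → (z ^ 2) ^ (suc (toℕ j) ℕ.* (q ∸ 1)) ≈ w ^ suc (toℕ j)
    regroup j = trans (^-congʳ (z ^ 2) (ℕ.*-comm (suc (toℕ j)) (q ∸ 1))) (sym (^-assocʳ (z ^ 2) (q ∸ 1) (suc (toℕ j))))
    z²w≈z̄² : z * z * w ≈ z̄ * z̄
    z²w≈z̄² = begin
      z * z * w               ≈⟨ *-congʳ (square z) ⟨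
      (z ^ 2) ^ suc (q ∸ 1)   ≈⟨ ^-congʳ (z ^ 2) q≡1+[q∸1] ⟨
      (z ^ 2) ^ q             ≈⟨ ^-comm z 2 q ⟩
      z̄ ^ 2                   ≈⟨ square z̄ ⟩
      z̄ * z̄                   ∎
    z̄w^h≈z : z̄ * w ^ h ≈ z
    z̄w^h≈z = begin
      z̄ * w ^ h                    ≈⟨ *-congˡ (^-comm (z ^ 2) (q ∸ 1) h) ⟩
      z̄ * ((z ^ 2) ^ h) ^ (q ∸ 1)  ≈⟨ *-congˡ (^-congˡ (q ∸ 1) (trans (^-assocʳ z 2 h) (^-congʳ z (≡.sym q≡2*h)))) ⟩
      z̄ ^ suc (q ∸ 1)              ≈⟨ ^-congʳ z̄ q≡1+[q∸1] ⟨
      z̄ ^ q                        ≈⟨ x^q^q≈x z ⟩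
      z                            ∎
    ττS≈τz̄ : τ * (τ * S) ≈ τ * z̄
    ττS≈τz̄ = begin
      (z + z̄) * ((z + z̄) * S)
        ≈⟨ solve 3 (λ z y s → (z :+ y) :* ((z :+ y) :* s) := (z :* z :+ y :* y) :* s :+ (z :* y :* s :+ z :* y :* s)) refl z z̄ S ⟩
      (z * z + z̄ * z̄) * S + (z * z̄ * S + z * z̄ * S)
        ≈⟨ trans (+-congˡ (x+x≈0 _)) (+-identityʳ _) ⟩
      (z * z + z̄ * z̄) * S
        ≈⟨ *-congʳ (+-congˡ z²w≈z̄²) ⟨
      (z * z + z * z * w) * S
        ≈⟨ solve 3 (λ z w s → (z :* z :+ z :* z :* w) :* s := z :* z :* ((con 1 :+ w) :* s)) refl z w S ⟩
      z * z * ((1# + w) * S)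
        ≈⟨ *-congˡ (geometric h w) ⟩
      z * z * (w + w * w ^ h)
        ≈⟨ solve 3 (λ z w p → z :* z :* (w :+ w :* p) := z :* z :* w :+ z :* z :* w :* p) refl z w (w ^ h) ⟩
      z * z * w + z * z * w * w ^ h
        ≈⟨ +-cong z²w≈z̄² (*-congʳ z²w≈z̄²) ⟩
      z̄ * z̄ + z̄ * z̄ * w ^ h
        ≈⟨ +-congˡ (trans (*-assoc _ _ _) (*-congˡ z̄w^h≈z)) ⟩
      z̄ * z̄ + z̄ * z
        ≈⟨ solve 2 (λ z y → y :* y :+ y :* z := (z :+ y) :* y) refl z z̄ ⟩
      (z + z̄) * z̄ ∎
    -- For τ = 0 the right side vanishes by the convention 0⁻¹ = 0. Here z lies in 𝔽_q, so w is zero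
    -- or one, and in the latter case S adds up an even number of ones.
    S≈0 : Fixed z → Dec (z ≈ 0#) → S ≈ 0#
    S≈0 _ (yes z≈0) = Sum.sum-zero {h} _ (λ j → trans (*-congʳ w≈0) (zeroˡ _))
      where
      w≈0 : w ≈ 0#
      w≈0 = trans (^-congˡ (q ∸ 1) (trans (*-congʳ z≈0) (zeroˡ _)))
                  (0^n≈0 (ℕ.∸-monoˡ-≤ 1 (ℕ.≤-trans (s≤s (s≤s z≤n)) 4≤q)))
    S≈0 fz (no z≉0) = begin
      S                    ≈⟨ Sum.sum-cong-≋ {h} (λ j → trans (^-congˡ (suc (toℕ j)) w≈1) (1^n≈1 (suc (toℕ j)))) ⟩
      sum {h} (λ _ → 1#)   ≈⟨ Sum.sum-replicate h ⟩
      h ×.× 1#             ≈⟨ h×1≈0 ⟩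
      0#                   ∎
      where
      w≈1 : w ≈ 1#
      w≈1 = fixed⇒x^[q-1]≈1 (fixed-^ 2 fz) (^-nonzero 2 z≉0)
    evaluate : Dec (τ ≈ 0#) → S ≈ z̄ * τ ⁻¹
    evaluate (yes τ≈0) = trans (S≈0 (relTrace≈0⇒fixed τ≈0) (z ≟ 0#))
      (sym (trans (*-congˡ (x≈0⇒x⁻¹≈0 τ≈0)) (zeroʳ z̄)))
    evaluate (no τ≉0) = *-cancelˡ τ≉0 (begin
      τ * S            ≈⟨ *-cancelˡ τ≉0 ττS≈τz̄ ⟩
      z̄                ≈⟨ *-identityʳ z̄ ⟨
      z̄ * 1#           ≈⟨ *-congˡ (⁻¹-inverseʳ τ≉0) ⟨
      z̄ * (τ * τ ⁻¹)   ≈⟨ solve 3 (λ y t i → y :* (t :* i) := t :* (y :* i)) refl z̄ τ (τ ⁻¹) ⟩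
      τ * (z̄ * τ ⁻¹)   ∎)

  -- All exponents are multiples of q - 1, and y^(q-1) = 1 on 𝔽_q*.
  powerSum-scale : ∀ {y} → Fixed y → ¬ (y ≈ 0#) → ∀ x → powerSum (y * x) ≈ powerSum x
  powerSum-scale {y} fy y≉0 x = Sum.sum-cong-≋ {h} λ j → begin
    (y * x) ^ (suc (toℕ j) ℕ.* (q ∸ 1))
      ≈⟨ ^-distrib-* y x (suc (toℕ j) ℕ.* (q ∸ 1)) ⟩
    y ^ (suc (toℕ j) ℕ.* (q ∸ 1)) * x ^ (suc (toℕ j) ℕ.* (q ∸ 1))
      ≈⟨ *-congʳ (trans (^-congʳ y (ℕ.*-comm (suc (toℕ j)) (q ∸ 1))) (sym (^-assocʳ y (q ∸ 1) (suc (toℕ j))))) ⟩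
    (y ^ (q ∸ 1)) ^ suc (toℕ j) * x ^ (suc (toℕ j) ℕ.* (q ∸ 1))
      ≈⟨ *-congʳ (trans (^-congˡ (suc (toℕ j)) (fixed⇒x^[q-1]≈1 fy y≉0)) (1^n≈1 (suc (toℕ j)))) ⟩
    1# * x ^ (suc (toℕ j) ℕ.* (q ∸ 1))
      ≈⟨ *-identityˡ _ ⟩
    x ^ (suc (toℕ j) ℕ.* (q ∸ 1)) ∎

  T-cong : ∀ u → Congruent _≈_ _≈_ (T u)
  T-cong u x≈y = relTrace-cong (*-congˡ (powerSum-cong x≈y))

  T-fixed : ∀ u x → Fixed (T u x)
  T-fixed u x = relTrace-fixed _

  T-scale : ∀ u {y} → Fixed y → ¬ (y ≈ 0#) → ∀ x → T u (y * x) ≈ T u x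
  T-scale u fy y≉0 x = relTrace-cong (*-congˡ (powerSum-scale fy y≉0 x))

  -- The factor `relTrace z ⁻¹` lies in 𝔽_q and can be taken out of the relative trace.
  T-square : ∀ u z → T u (z ^ 2) ≈ relTrace (u * z ^ q) * relTrace z ⁻¹
  T-square u z = begin
    T u (z ^ 2)                               ≈⟨ relTrace-cong (*-congˡ (powerSum-square z)) ⟩
    relTrace (u * (z ^ q * relTrace z ⁻¹))    ≈⟨ relTrace-cong (solve 3 (λ u y i → u :* (y :* i) := i :* (u :* y)) refl u (z ^ q) (relTrace z ⁻¹)) ⟩
    relTrace (relTrace z ⁻¹ * (u * z ^ q))    ≈⟨ relTrace-scale (fixed-⁻¹ (relTrace-fixed z)) _ ⟩
    relTrace z ⁻¹ * relTrace (u * z ^ q)      ≈⟨ *-comm _ _ ⟩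
    relTrace (u * z ^ q) * relTrace z ⁻¹      ∎
    where open Solver using (solve; _:=_; _:*_)

  T-0 : ∀ u → T u 0# ≈ 0#
  T-0 u = begin
    T u 0#                                   ≈⟨ T-cong u (0^n≈0 (s≤s (z≤n {1}))) ⟨
    T u (0# ^ 2)                             ≈⟨ T-square u 0# ⟩
    relTrace (u * 0# ^ q) * relTrace 0# ⁻¹   ≈⟨ *-congˡ (x≈0⇒x⁻¹≈0 (fixed⇒relTrace≈0 fixed-0)) ⟩
    relTrace (u * 0# ^ q) * 0#               ≈⟨ zeroʳ _ ⟩
    0#                                       ∎

  module Subfield {p} {𝔽 : Pred Carrier p} (𝔽-subfield : IsSubfieldOfOrder (2 ℕ.^ m) 𝔽) where
    open IsSubfieldOfOrder 𝔽-subfield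
    private module E = Enumeration (enumerate size)

    ∈⇒fixed : ∀ {x} → x ∈ 𝔽 → Fixed x
    ∈⇒fixed x∈ = fermat (enumerate size) (ℕ.m^n>0 2 m) 0∈
      (λ x≉0 → *-permutation x≉0 (*-closed x∈) (*-closed (⁻¹-closed x∈ x≉0)))

    -- A fixed point outside 𝔽 would be a (q+1)-st root of x^q + x.
    fixed⇒∈ : ∀ {x} → Fixed x → x ∈ 𝔽
    fixed⇒∈ {x} fx with Fin.any? (λ i → E.elem i ≟ x)
    ... | yes (i , eq) = resp eq (E.elem∈ i)
    ... | no ∉ = contradiction (trans (sym (+-identityʳ 1#)) (root-bound q polynomial roots injective vanish)) 1≉0
      where
      roots : Fin (suc q) → Carrier
      roots zero    = x
      roots (suc i) = E.elem i
      injective : ∀ {i j} → roots i ≈ roots j → i ≡ j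
      injective {zero}  {zero}  eq = ≡.refl
      injective {zero}  {suc j} eq = contradiction (j , sym eq) ∉
      injective {suc i} {zero}  eq = contradiction (i , eq) ∉
      injective {suc i} {suc j} eq = ≡.cong suc (E.elem-injective eq)
      polynomial : Polynomial q (1# + 0#) (λ x → x ^ q + x ^ 1)
      polynomial = polynomial-+ q (polynomial-^ q)
        (polynomial-< (ℕ.≤⇒≤′ (ℕ.≤-trans (s≤s (s≤s z≤n)) 4≤q)) (polynomial-^ 1))
      vanish : ∀ i → roots i ^ q + roots i ^ 1 ≈ 0#
      vanish i = trans (+-cong (fixed i) (*-identityʳ _)) (x+x≈0 _)
        where
        fixed : ∀ i → Fixed (roots i)
        fixed zero    = fx
        fixed (suc i) = ∈⇒fixed (E.elem∈ i)

    -- From here on 𝔽_q is handled through the equation x^q = x alone; the given subfield only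
    -- supplies the listing.
    enumerateFixed : Enumeration setoid Fixed q
    enumerateFixed = record
      { elem = E.elem
      ; elem∈ = λ i → ∈⇒fixed (E.elem∈ i)
      ; elem-injective = E.elem-injective
      ; index = λ fx → E.index (fixed⇒∈ fx)
      ; elem-index = λ fx → E.elem-index (fixed⇒∈ fx)
      }

-- Sums of the additive character over `K` and over 𝔽_q.

module CharacterSums {c ℓ} (m : ℕ) (2≤m : 2 ≤ m) (K : FiniteField c ℓ (2 ℕ.^ (2 ℕ.* m)))
  (E : Enumeration (FiniteField.setoid K) (QuadraticExtension.Fixed m 2≤m K) (2 ℕ.^ m)) where
  open FiniteField K hiding (zero)
  open HyperBentness m K
  open FieldProperties K
  open QuadraticExtension m 2≤m K
  open Enumeration E
  open SemiringSolver commutativeSemiring using (solve; _:=_; _:+_; _:*_)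

  sumF : (Carrier → ℤ) → ℤ
  sumF g = Σℤ.sum (λ i → g (elem i))

  sumℤ-cong : ∀ {f g} → (∀ x → f x ≡ g x) → sumℤ f ≡ sumℤ g
  sumℤ-cong f≡g = Σℤ.sum-cong-≗ {2 ℕ.^ n} (λ i → f≡g (Enumeration.elem enumerateAll i))

  sumF-cong : ∀ {f g} → (∀ {x} → Fixed x → f x ≡ g x) → sumF f ≡ sumF g
  sumF-cong f≡g = Σℤ.sum-cong-≗ {q} (λ i → f≡g (elem∈ i))

  sumF-const : ∀ x → sumF (λ _ → x) ≡ + q ℤ.* x
  sumF-const = sum-const q

  sumℤ-reindex : ∀ {φ} → PermutationOn setoid Everything φ → ∀ g → Congruent _≈_ _≡_ g →
                 sumℤ g ≡ sumℤ (λ x → g (φ x))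
  sumℤ-reindex = Σℤ.sum-reindex enumerateAll

  sumℤ-supported : ∀ g → Congruent _≈_ _≡_ g → (∀ {x} → ¬ Fixed x → g x ≡ 0ℤ) → sumℤ g ≡ sumF g
  sumℤ-supported g g-cong vanish =
    Σℤ.sum-supported enumerateAll E (λ _ → tt) fixed? _≟_ g g-cong (λ _ → vanish)

  sumF-sumℤ-comm : ∀ (s : Carrier → ℤ) (g : Carrier → Carrier → ℤ) →
    sumF (λ y → sumℤ (λ x → s x ℤ.* g x y)) ≡ sumℤ (λ x → s x ℤ.* sumF (g x))
  sumF-sumℤ-comm s g = ≡.trans
    (Σℤ.∑-comm {q} {2 ℕ.^ n} (λ j i → s (all i) ℤ.* g (all i) (elem j)))
    (sumℤ-cong (λ x → ≡.sym (Σℤ.*-distribˡ-sum (s x) (λ i → g x (elem i)))))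
    where all = Enumeration.elem enumerateAll

  -- Subtracting `b` from every value leaves only the term at zero. This form sums over all of 𝔽_q
  -- and so avoids a separate listing of 𝔽_q*.
  sumF-two-values : ∀ {g a b} → (∀ {y} → y ≈ 0# → g y ≡ a) → (∀ {y} → Fixed y → ¬ (y ≈ 0#) → g y ≡ b) →
                    sumF g ≡ (a ℤ.- b) ℤ.+ + q ℤ.* b
  sumF-two-values {g} {a} {b} at-0 else-b = begin
    sumF g                                             ≡⟨ sumF-cong (λ {y} _ → split (g y) b) ⟩
    sumF (λ y → (g y ℤ.- b) ℤ.+ b)                     ≡⟨ Σℤ.∑-distrib-+ (λ i → g (elem i) ℤ.- b) (λ _ → b) ⟩
    sumF (λ y → g y ℤ.- b) ℤ.+ sumF (λ _ → b)          ≡⟨ ≡.cong₂ ℤ._+_ single (sumF-const b) ⟩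
    (a ℤ.- b) ℤ.+ + q ℤ.* b                            ∎
    where
    open ≡.≡-Reasoning
    split : ∀ x y → x ≡ (x ℤ.- y) ℤ.+ y
    split = solve-∀
    single : sumF (λ y → g y ℤ.- b) ≡ a ℤ.- b
    single = ≡.trans
      (Σℤ.sum-single _ (index fixed-0) (λ i i≢ → ℤ.i≡j⇒i-j≡0 (else-b (elem∈ i) λ eq →
        i≢ (elem-injective (trans eq (sym (elem-index fixed-0)))))))
      (≡.cong (ℤ._- b) (at-0 (elem-index fixed-0)))

  χ : Carrier → ℤ
  χ y = sign (absTrace m y)

  χ-cong : Congruent _≈_ _≡_ χ
  χ-cong x≈y = sign-cong (absTrace-cong m x≈y)

  χ-0 : ∀ {x} → x ≈ 0# → χ x ≡ 1ℤ
  χ-0 x≈0 = sign-0 (trans (absTrace-cong m x≈0) (absTrace-0 m))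

  χ-+ : ∀ {x y} → Fixed x → Fixed y → χ (x + y) ≡ χ x ℤ.* χ y
  χ-+ {x} {y} fx fy = ≡.trans (sign-cong (absTrace-+ m x y)) (sign-+ (absTrace-bit m fx) (absTrace-bit m fy))

  -- Together with `sumF-χ-nonzero` this is the orthogonality relation that every averaging argument
  -- below relies on.
  sumF-χ-zero : ∀ {d} → d ≈ 0# → sumF (λ y → χ (y * d)) ≡ + q
  sumF-χ-zero d≈0 = ≡.trans (sumF-cong (λ {y} _ → χ-0 (trans (*-congˡ d≈0) (zeroʳ y))))
    (≡.trans (sumF-const 1ℤ) (ℤ.*-identityʳ _))

  -- Translating y by y₀ with χ (y₀ d) = −1 changes the sign of the sum.
  sumF-χ-nonzero : ∀ {d} → Fixed d → ¬ (d ≈ 0#) → sumF (λ y → χ (y * d)) ≡ 0ℤ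
  sumF-χ-nonzero {d} fd d≉0 with absTrace-nontrivial m (ℕ.≤-trans (s≤s z≤n) 2≤m) E
  ... | y₁ , fy₁ , Tr≉0 = self-negative (begin
    sumF (λ y → χ (y * d))                    ≡⟨ Σℤ.sum-reindex E translation (λ y → χ (y * d)) (λ eq → χ-cong (*-congʳ eq)) ⟩
    sumF (λ y → χ ((y + y₀) * d))             ≡⟨ sumF-cong (λ {y} fy → flip fy) ⟩
    sumF (λ y → -1ℤ ℤ.* χ (y * d))            ≡⟨ Σℤ.*-distribˡ-sum -1ℤ (λ i → χ (elem i * d)) ⟨
    -1ℤ ℤ.* sumF (λ y → χ (y * d))            ≡⟨ ℤ.-1*i≡-i _ ⟩
    ℤ.- sumF (λ y → χ (y * d))                ∎)
    where
    open ≡.≡-Reasoning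
    y₀ = y₁ * d ⁻¹
    fy₀ : Fixed y₀
    fy₀ = fixed-* fy₁ (fixed-⁻¹ fd)
    y₀d≈y₁ : y₀ * d ≈ y₁
    y₀d≈y₁ = trans (*-assoc _ _ _) (trans (*-congˡ (⁻¹-inverseˡ d≉0)) (*-identityʳ y₁))
    flip : ∀ {y} → Fixed y → χ ((y + y₀) * d) ≡ -1ℤ ℤ.* χ (y * d)
    flip {y} fy = begin
      χ ((y + y₀) * d)          ≡⟨ χ-cong (trans (distribʳ d y y₀) (+-congˡ y₀d≈y₁)) ⟩
      χ (y * d + y₁)            ≡⟨ χ-+ (fixed-* fy fd) fy₁ ⟩
      χ (y * d) ℤ.* χ y₁        ≡⟨ ≡.cong (χ (y * d) ℤ.*_) (sign-nonzero Tr≉0) ⟩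
      χ (y * d) ℤ.* -1ℤ         ≡⟨ ℤ.*-comm (χ (y * d)) -1ℤ ⟩
      -1ℤ ℤ.* χ (y * d)         ∎
    translation : PermutationOn setoid Fixed (_+ y₀)
    translation = record
      { inv = _+ y₀
      ; cong = +-congʳ
      ; inv-cong = +-congʳ
      ; closed = λ fy → fixed-+ fy fy₀
      ; inv∈ = λ fy → fixed-+ fy fy₀
      ; φ-inv = λ _ → x+y+y≈x _ y₀
      ; inv-φ = λ _ → x+y+y≈x _ y₀
      }
    self-negative : ∀ {i} → i ≡ ℤ.- i → i ≡ 0ℤ
    self-negative {+ zero} _ = ≡.refl
    self-negative {+ suc _} ()
    self-negative { -[1+ _ ]} ()

  -- The Walsh spectrum of a single component function.

  module Component (u₀ : Carrier) (Tr[u₀]≉0 : ¬ (relTrace u₀ ≈ 0#))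
                   (b : Carrier) (fb : Fixed b) (b≉0 : ¬ (b ≈ 0#)) where

    s : Carrier → ℤ
    s x = χ (b * T u₀ x)

    s-cong : Congruent _≈_ _≡_ s
    s-cong x≈y = χ-cong (*-congˡ (T-cong u₀ x≈y))

    s-0 : ∀ {x} → x ≈ 0# → s x ≡ 1ℤ
    s-0 x≈0 = χ-0 (trans (*-congˡ (trans (T-cong u₀ x≈0) (T-0 u₀))) (zeroʳ b))

    s-scale : ∀ {y} → Fixed y → ¬ (y ≈ 0#) → ∀ x → s (y * x) ≡ s x
    s-scale fy y≉0 x = χ-cong (*-congˡ (T-scale u₀ fy y≉0 x))

    private
      -- This is `s` at z², in the closed form of `T-square`.
      r : Carrier → ℤ
      r z = χ (b * (relTrace (u₀ * z ^ q) * relTrace z ⁻¹))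

      -- The rate at which the argument of χ in `r` grows under translations of z by 𝔽_q. It is
      -- nonzero exactly when z lies outside 𝔽_q.
      d : Carrier → Carrier
      d z = b * relTrace u₀ * relTrace z ⁻¹

      r-cong : Congruent _≈_ _≡_ r
      r-cong eq = χ-cong (*-congˡ (*-cong (relTrace-cong (*-congˡ (^-congˡ q eq))) (⁻¹-cong (relTrace-cong eq))))

      d-cong : Congruent _≈_ _≈_ d
      d-cong eq = *-congˡ (⁻¹-cong (relTrace-cong eq))

      d-fixed : ∀ z → Fixed (d z)
      d-fixed z = fixed-* (fixed-* fb (relTrace-fixed u₀)) (fixed-⁻¹ (relTrace-fixed z))

      -- Conjugation fixes y, so the numerator grows by y Trₘⁿ(u₀), while the denominator is
      -- unchanged because Trₘⁿ(y) = 0.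
      r-translate : ∀ {y} → Fixed y → ∀ z → r (z + y) ≡ r z ℤ.* χ (y * d z)
      r-translate {y} fy z = ≡.trans (χ-cong expand)
        (χ-+ (fixed-* fb (fixed-* (relTrace-fixed _) (fixed-⁻¹ (relTrace-fixed z)))) (fixed-* fy (d-fixed z)))
        where
        open SetoidReasoning setoid
        numerator : relTrace (u₀ * (z + y) ^ q) ≈ relTrace (u₀ * z ^ q) + y * relTrace u₀
        numerator = begin
          relTrace (u₀ * (z + y) ^ q)                  ≈⟨ relTrace-cong (*-congˡ (trans (frobenius-+ m z y) (+-congˡ fy))) ⟩
          relTrace (u₀ * (z ^ q + y))                  ≈⟨ relTrace-cong (trans (distribˡ u₀ (z ^ q) y) (+-congˡ (*-comm u₀ y))) ⟩
          relTrace (u₀ * z ^ q + y * u₀)               ≈⟨ relTrace-+ _ _ ⟩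
          relTrace (u₀ * z ^ q) + relTrace (y * u₀)    ≈⟨ +-congˡ (relTrace-scale fy u₀) ⟩
          relTrace (u₀ * z ^ q) + y * relTrace u₀      ∎
        denominator : relTrace (z + y) ≈ relTrace z
        denominator = trans (relTrace-+ z y) (trans (+-congˡ (fixed⇒relTrace≈0 fy)) (+-identityʳ _))
        expand : b * (relTrace (u₀ * (z + y) ^ q) * relTrace (z + y) ⁻¹) ≈
                 b * (relTrace (u₀ * z ^ q) * relTrace z ⁻¹) + y * d z
        expand = begin
          b * (relTrace (u₀ * (z + y) ^ q) * relTrace (z + y) ⁻¹)
            ≈⟨ *-congˡ (*-cong numerator (⁻¹-cong denominator)) ⟩
          b * ((relTrace (u₀ * z ^ q) + y * relTrace u₀) * relTrace z ⁻¹)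
            ≈⟨ solve 5 (λ b v y u i → b :* ((v :+ y :* u) :* i) := b :* (v :* i) :+ y :* (b :* u :* i))
                 refl b (relTrace (u₀ * z ^ q)) y (relTrace u₀) (relTrace z ⁻¹) ⟩
          b * (relTrace (u₀ * z ^ q) * relTrace z ⁻¹) + y * d z ∎

      translation : ∀ y → PermutationOn setoid Everything (_+ y)
      translation y = record
        { inv = _+ y
        ; cong = +-congʳ
        ; inv-cong = +-congʳ
        ; closed = λ _ → tt
        ; inv∈ = λ _ → tt
        ; φ-inv = λ _ → x+y+y≈x _ y
        ; inv-φ = λ _ → x+y+y≈x _ y
        }

      -- The inverse is the (n - 1)-fold Frobenius map, since n-fold Frobenius is the identity on
      -- `K`.
      squaring : PermutationOn setoid Everything (_^ 2)
      squaring = record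
        { inv = _^ (2 ℕ.^ (n ∸ 1))
        ; cong = ^-congˡ 2
        ; inv-cong = ^-congˡ (2 ℕ.^ (n ∸ 1))
        ; closed = λ _ → tt
        ; inv∈ = λ _ → tt
        ; φ-inv = λ {x} _ → trans (^-comm x (2 ℕ.^ (n ∸ 1)) 2) (root x)
        ; inv-φ = λ {x} _ → root x
        }
        where
        1≤n : 1 ≤ n
        1≤n = ℕ.≤-trans (ℕ.≤-trans (s≤s z≤n) 2≤m) (ℕ.m≤m+n m _)
        root : ∀ x → (x ^ 2) ^ (2 ℕ.^ (n ∸ 1)) ≈ x
        root x = trans (^-assocʳ x 2 (2 ℕ.^ (n ∸ 1)))
          (trans (^-congʳ x (≡.cong (2 ℕ.^_) (ℕ.m+[n∸m]≡n 1≤n))) (x^|K|≈x x))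

    -- After x = z², averaging over the translations z ↦ z + y with y ∈ 𝔽_q
    -- leaves only the terms with z ∈ 𝔽_q.
    sum-s : sumℤ s ≡ + q
    sum-s = ℤ.*-cancelˡ-≡ (+ q) _ _ {{ℕ.m^n≢0 2 m}} (begin
      + q ℤ.* sumℤ s                                          ≡⟨ ≡.cong (+ q ℤ.*_) s≡r ⟩
      + q ℤ.* sumℤ r                                          ≡⟨ sumF-const (sumℤ r) ⟨
      sumF (λ _ → sumℤ r)                                     ≡⟨ sumF-cong (λ {y} fy →
                                                                   ≡.trans (sumℤ-reindex (translation y) r r-cong) (sumℤ-cong (r-translate fy))) ⟩
      sumF (λ y → sumℤ (λ z → r z ℤ.* χ (y * d z)))           ≡⟨ sumF-sumℤ-comm r (λ z y → χ (y * d z)) ⟩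
      sumℤ (λ z → r z ℤ.* sumF (λ y → χ (y * d z)))           ≡⟨ sumℤ-supported _ v-cong v-vanish ⟩
      sumF (λ z → r z ℤ.* sumF (λ y → χ (y * d z)))           ≡⟨ sumF-cong v-fixed ⟩
      sumF (λ _ → + q)                                        ≡⟨ sumF-const (+ q) ⟩
      + q ℤ.* + q                                             ∎)
      where
      open ≡.≡-Reasoning
      s≡r : sumℤ s ≡ sumℤ r
      s≡r = ≡.trans (sumℤ-reindex squaring s s-cong) (sumℤ-cong (λ z → χ-cong (*-congˡ (T-square u₀ z))))
      v-cong : Congruent _≈_ _≡_ (λ z → r z ℤ.* sumF (λ y → χ (y * d z)))
      v-cong eq = ≡.cong₂ ℤ._*_ (r-cong eq) (sumF-cong (λ {y} _ → χ-cong (*-congˡ {y} (d-cong eq))))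
      v-vanish : ∀ {z} → ¬ Fixed z → r z ℤ.* sumF (λ y → χ (y * d z)) ≡ 0ℤ
      v-vanish {z} ¬fz = ≡.trans (≡.cong (r z ℤ.*_) (sumF-χ-nonzero (d-fixed z) d≉0)) (ℤ.*-zeroʳ (r z))
        where
        d≉0 : ¬ (d z ≈ 0#)
        d≉0 = *-nonzero (*-nonzero b≉0 Tr[u₀]≉0) (⁻¹-nonzero (λ eq → ¬fz (relTrace≈0⇒fixed eq)))
      -- On 𝔽_q the denominator vanishes, so 0⁻¹ = 0 makes both `r z` equal to one and `d z` equal
      -- to zero; each of the q elements contributes q.
      v-fixed : ∀ {z} → Fixed z → r z ℤ.* sumF (λ y → χ (y * d z)) ≡ + q
      v-fixed {z} fz = ≡.trans (≡.cong₂ ℤ._*_ r≡1 (sumF-χ-zero (trans (*-congˡ Tr⁻¹≈0) (zeroʳ _)))) (ℤ.*-identityˡ _)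
        where
        Tr⁻¹≈0 : relTrace z ⁻¹ ≈ 0#
        Tr⁻¹≈0 = x≈0⇒x⁻¹≈0 (fixed⇒relTrace≈0 fz)
        r≡1 : r z ≡ 1ℤ
        r≡1 = χ-0 (trans (*-congˡ (trans (*-congˡ Tr⁻¹≈0) (zeroʳ _))) (zeroʳ b))

    module _ (k k′ : ℕ) (root : ∀ x → (x ^ k) ^ k′ ≈ x) where
      private
        root′ : ∀ x → (x ^ k′) ^ k ≈ x
        root′ x = trans (^-comm x k′ k) (root x)

        0^k≈0 : 0# ^ k ≈ 0#
        0^k≈0 = go k root
          where
          go : ∀ k → (∀ x → (x ^ k) ^ k′ ≈ x) → 0# ^ k ≈ 0#
          -- With exponent zero every power would be one, and `root` at zero would give 1 = 0.
          go zero root = contradiction (trans (sym (1^n≈1 k′)) (root 0#)) 1≉0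
          go (suc k) _ = zeroˡ _

        powerF : PermutationOn setoid Fixed (_^ k)
        powerF = record
          { inv = _^ k′
          ; cong = ^-congˡ k
          ; inv-cong = ^-congˡ k′
          ; closed = fixed-^ k
          ; inv∈ = fixed-^ k′
          ; φ-inv = λ {x} _ → root′ x
          ; inv-φ = λ {x} _ → root x
          }

        *-permutationK : ∀ {a} → ¬ (a ≈ 0#) → PermutationOn setoid Everything (a *_)
        *-permutationK a≉0 = *-permutation a≉0 (λ _ → tt) (λ _ → tt)

      -- Averaging over the dilations x ↦ y x with y ∈ 𝔽_q*, which leave s
      -- unchanged, leaves only the x with Trₘⁿ(l xᵏ) = 0: these form {0} ∪ x₀ 𝔽_q*.
      walsh-power : ∀ {l} → ¬ (l ≈ 0#) →
        sumℤ (λ x → s x ℤ.* χ (relTrace (l * x ^ k))) ≡ s ((l ⁻¹) ^ k′) ℤ.* + q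
      walsh-power {l} l≉0 = cancel (begin
        -- The dilation by y = 0 gives the full sum of `s`, which is q; each of the other q - 1
        -- dilations gives `W`.
        (+ q ℤ.- W) ℤ.+ + q ℤ.* W
          ≡⟨ sumF-two-values dilated-0 dilated ⟨
        sumF (λ y → sumℤ (λ x → s x ℤ.* χ (y ^ k * e x)))
          ≡⟨ sumF-sumℤ-comm s (λ x y → χ (y ^ k * e x)) ⟩
        sumℤ (λ x → s x ℤ.* sumF (λ y → χ (y ^ k * e x)))
          -- As y runs through 𝔽_q so does y^k, and the inner sum becomes one covered by
          -- orthogonality.
          ≡⟨ sumℤ-cong (λ x → ≡.cong (s x ℤ.*_) (≡.sym
               (Σℤ.sum-reindex E powerF (λ y → χ (y * e x)) (λ eq → χ-cong (*-congʳ eq))))) ⟩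
        sumℤ v
          ≡⟨ sumℤ-reindex (*-permutationK x₀≉0) v v-cong ⟩
        sumℤ (λ a → v (x₀ * a))
          ≡⟨ sumℤ-supported _ (λ eq → v-cong (*-congˡ eq)) v-vanish ⟩
        sumF (λ a → v (x₀ * a))
          ≡⟨ sumF-two-values v-0 v-fixed ⟩
        (+ q ℤ.- s x₀ ℤ.* + q) ℤ.+ + q ℤ.* (s x₀ ℤ.* + q) ∎)
        where
        open ≡.≡-Reasoning
        -- Chosen so that l x₀^k = 1. Substituting x = x₀ a turns the condition Trₘⁿ(l x^k) = 0 into
        -- a^k ∈ 𝔽_q, which is a ∈ 𝔽_q.
        x₀ : Carrier
        x₀ = (l ⁻¹) ^ k′
        x₀≉0 : ¬ (x₀ ≈ 0#)
        x₀≉0 = ^-nonzero k′ (⁻¹-nonzero l≉0)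
        e : Carrier → Carrier
        e x = relTrace (l * x ^ k)
        e-cong : Congruent _≈_ _≈_ e
        e-cong eq = relTrace-cong (*-congˡ (^-congˡ k eq))
        W : ℤ
        W = sumℤ (λ x → s x ℤ.* χ (e x))
        v : Carrier → ℤ
        v x = s x ℤ.* sumF (λ y → χ (y * e x))
        v-cong : Congruent _≈_ _≡_ v
        v-cong eq = ≡.cong₂ ℤ._*_ (s-cong eq) (sumF-cong (λ {y} _ → χ-cong (*-congˡ {y} (e-cong eq))))
        dilated-0 : ∀ {y} → y ≈ 0# → sumℤ (λ x → s x ℤ.* χ (y ^ k * e x)) ≡ + q
        dilated-0 {y} y≈0 = ≡.trans (sumℤ-cong (λ x →
          ≡.trans (≡.cong (s x ℤ.*_) (χ-0 (trans (*-congʳ (trans (^-congˡ k y≈0) 0^k≈0)) (zeroˡ (e x))))) (ℤ.*-identityʳ (s x)))) sum-s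
        dilated : ∀ {y} → Fixed y → ¬ (y ≈ 0#) → sumℤ (λ x → s x ℤ.* χ (y ^ k * e x)) ≡ W
        dilated {y} fy y≉0 = ≡.sym (≡.trans
          (sumℤ-reindex (*-permutationK y≉0) (λ x → s x ℤ.* χ (e x)) (λ eq → ≡.cong₂ ℤ._*_ (s-cong eq) (χ-cong (e-cong eq))))
          (sumℤ-cong (λ x → ≡.cong₂ ℤ._*_ (s-scale fy y≉0 x) (χ-cong (e-dilate x)))))
          where
          e-dilate : ∀ x → e (y * x) ≈ y ^ k * e x
          e-dilate x = trans
            (relTrace-cong (trans (*-congˡ (^-distrib-* y x k))
              (solve 3 (λ l a b → l :* (a :* b) := a :* (l :* b)) refl l (y ^ k) (x ^ k))))
            (relTrace-scale (fixed-^ k fy) _)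
        e-x₀ : ∀ a → e (x₀ * a) ≈ relTrace (a ^ k)
        e-x₀ a = relTrace-cong (trans (*-congˡ (trans (^-distrib-* x₀ a k) (*-congʳ (root′ (l ⁻¹)))))
          (trans (sym (*-assoc _ _ _)) (trans (*-congʳ (⁻¹-inverseʳ l≉0)) (*-identityˡ _))))
        v-vanish : ∀ {a} → ¬ Fixed a → v (x₀ * a) ≡ 0ℤ
        v-vanish {a} ¬fa = ≡.trans (≡.cong (s (x₀ * a) ℤ.*_) (sumF-χ-nonzero (relTrace-fixed _) e≉0)) (ℤ.*-zeroʳ (s (x₀ * a)))
          where
          e≉0 : ¬ (e (x₀ * a) ≈ 0#)
          e≉0 eq = ¬fa (fixed-resp (root a) (fixed-^ k′ (relTrace≈0⇒fixed (trans (sym (e-x₀ a)) eq))))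
        v≡s*q : ∀ {a} → Fixed a → v (x₀ * a) ≡ s (x₀ * a) ℤ.* + q
        v≡s*q {a} fa = ≡.cong (s (x₀ * a) ℤ.*_)
          (sumF-χ-zero (trans (e-x₀ a) (fixed⇒relTrace≈0 (fixed-^ k fa))))
        v-0 : ∀ {a} → a ≈ 0# → v (x₀ * a) ≡ + q
        v-0 {a} a≈0 = ≡.trans (v≡s*q (fixed-resp (sym a≈0) fixed-0))
          (≡.trans (≡.cong (ℤ._* + q) (s-0 (trans (*-congˡ a≈0) (zeroʳ x₀)))) (ℤ.*-identityˡ (+ q)))
        v-fixed : ∀ {a} → Fixed a → ¬ (a ≈ 0#) → v (x₀ * a) ≡ s x₀ ℤ.* + q
        v-fixed {a} fa a≉0 = ≡.trans (v≡s*q fa)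
          (≡.cong (ℤ._* + q) (≡.trans (s-cong (*-comm x₀ a)) (s-scale fa a≉0 x₀)))
        -- Both sides have the shape q + (q - 1) X, and q - 1 is positive.
        cancel : ∀ {X Y} → (+ q ℤ.- X) ℤ.+ + q ℤ.* X ≡ (+ q ℤ.- Y) ℤ.+ + q ℤ.* Y → X ≡ Y
        cancel {X} {Y} eq = ℤ.*-cancelˡ-≡ (+ (q ∸ 1)) X Y {{ℕ.>-nonZero (ℕ.∸-monoˡ-≤ 1 (ℕ.≤-trans (s≤s (s≤s z≤n)) 4≤q))}}
          (GroupProperties.∙-cancelˡ (AbelianGroup.group ℤ.+-0-abelianGroup) (+ q) _ _ (≡.trans (≡.sym (collect X)) (≡.trans eq (collect Y))))
          where
          identity : ∀ p X → ((1ℤ ℤ.+ p) ℤ.- X) ℤ.+ (1ℤ ℤ.+ p) ℤ.* X ≡ (1ℤ ℤ.+ p) ℤ.+ p ℤ.* X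
          identity = solve-∀
          collect : ∀ X → (+ q ℤ.- X) ℤ.+ + q ℤ.* X ≡ + q ℤ.+ + (q ∸ 1) ℤ.* X
          collect X = ≡.subst (λ j → (+ j ℤ.- X) ℤ.+ + j ℤ.* X ≡ + j ℤ.+ + (q ∸ 1) ℤ.* X)
            (≡.sym q≡1+[q∸1]) (identity (+ (q ∸ 1)) X)

    f : Carrier → Carrier
    f x = absTrace m (b * T u₀ x)

    f-bit : ∀ x → Bit (f x)
    f-bit x = absTrace-bit m (fixed-* fb (T-fixed u₀ x))

    walsh-value : ∀ l t → ℤ.gcd t (+ (2 ℕ.^ n ∸ 1)) ≡ 1ℤ →
                  walsh f l t ≡ + q ⊎ walsh f l t ≡ ℤ.- + q
    walsh-value l t gcd≡1 with Powers.^ℤ-permutation K 3≤N t gcd≡1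
      where
      3≤N : 3 ≤ 2 ℕ.^ n
      3≤N = ℕ.≤-trans (ℕ.≤-trans (s≤s (s≤s (s≤s z≤n))) 4≤q) (ℕ.^-monoʳ-≤ 2 (ℕ.m≤m+n m (m ℕ.+ 0)))
    ... | k , k′ , power , root = go (l ≟ 0#)
      where
      open ≡.≡-Reasoning
      walsh≡ : walsh f l t ≡ sumℤ (λ x → s x ℤ.* χ (relTrace (l * x ^ k)))
      walsh≡ = sumℤ-cong λ x → begin
        sign (f x + absTrace n (l * x ^ℤ t))          ≡⟨ sign-+ (f-bit x) (absTrace-bit n (x^|K|≈x _)) ⟩
        s x ℤ.* sign (absTrace n (l * x ^ℤ t))        ≡⟨ ≡.cong (s x ℤ.*_) (sign-cong (trans (absTrace-cong n (*-congˡ (power x))) (absTrace-tower _))) ⟩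
        s x ℤ.* χ (relTrace (l * x ^ k))              ∎
      signed : ∀ {i} → i ≡ 1ℤ ⊎ i ≡ -1ℤ → i ℤ.* + q ≡ + q ⊎ i ℤ.* + q ≡ ℤ.- + q
      signed (inj₁ ≡.refl) = inj₁ (ℤ.*-identityˡ (+ q))
      signed (inj₂ ≡.refl) = inj₂ (ℤ.-1*i≡-i (+ q))
      go : Dec (l ≈ 0#) → walsh f l t ≡ + q ⊎ walsh f l t ≡ ℤ.- + q
      -- At l = 0 the Walsh sum is the plain sum of `s`, whatever the exponent.
      go (yes l≈0) = inj₁ (begin
        walsh f l t                                        ≡⟨ walsh≡ ⟩
        sumℤ (λ x → s x ℤ.* χ (relTrace (l * x ^ k)))      ≡⟨ sumℤ-cong (λ x → ≡.trans (≡.cong (s x ℤ.*_) (χ-0 (trivial x))) (ℤ.*-identityʳ (s x))) ⟩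
        sumℤ s                                             ≡⟨ sum-s ⟩
        + q                                                ∎)
        where
        trivial : ∀ x → relTrace (l * x ^ k) ≈ 0#
        trivial x = trans (relTrace-cong (trans (*-congʳ l≈0) (zeroˡ _))) (fixed⇒relTrace≈0 fixed-0)
      go (no l≉0) = ≡.subst (λ i → i ≡ + q ⊎ i ≡ ℤ.- + q)
        (≡.sym (≡.trans walsh≡ (walsh-power k k′ root l≉0))) (signed (sign-±1 _))

    hyperBent : IsHyperBent f
    hyperBent = record
      { boolean = record
        { cong = λ eq → absTrace-cong m (*-congˡ (T-cong u₀ eq))
        ; values = f-bit
        }
      ; spectrum = walsh-value
      }

-- From the given subfield and subgroup to the fixed points of conjugation.

theorem3 : ∀ {c ℓ p₁ p₂ : Level} (m : ℕ) → 2 ≤ m →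
    (K : FiniteField c ℓ (2 ℕ.^ (2 ℕ.* m))) →
    let open FiniteField K
        open HyperBentness m K in
    (𝔽 : Pred Carrier p₁) → IsSubfieldOfOrder (2 ℕ.^ m) 𝔽 →
    (U : Pred Carrier p₂) → IsCyclicSubgroupOfOrder (2 ℕ.^ m ℕ.+ 1) U →
    (u₀ : Carrier) → u₀ ∈ U → ¬ (u₀ ≈ 1#) →
    IsVectorialHyperBent 𝔽 (T u₀)
theorem3 m 2≤m K 𝔽 𝔽-subfield U U-subgroup u₀ u₀∈U u₀≉1 = record
  { cong = T-cong u₀
  ; values = λ x → fixed⇒∈ (T-fixed u₀ x)
  ; components = λ b b∈𝔽 b≉0 →
      CharacterSums.Component.hyperBent m 2≤m K enumerateFixed u₀
        -- A vanishing relative trace would put u₀ into 𝔽_q, but `U` meets 𝔽_q only in one.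
        (λ eq → u₀-not-fixed (relTrace≈0⇒fixed eq)) b (∈⇒fixed b∈𝔽) b≉0
  }
  where
  open FiniteField K hiding (zero)
  open HyperBentness m K
  open FieldProperties K
  open QuadraticExtension m 2≤m K
  open Subfield 𝔽-subfield
  module U = IsCyclicSubgroupOfOrder U-subgroup
  open SetoidReasoning setoid

  -- Multiplication by u₀ permutes `U`, which has q + 1 elements, all nonzero.
  u₀^[q+1]≈1 : u₀ ^ (q ℕ.+ 1) ≈ 1#
  u₀^[q+1]≈1 = lagrange (enumerate U.size) (U.nonzero u₀∈U)
    (*-permutation (U.nonzero u₀∈U) (U.*-closed u₀∈U) (U.*-closed (U.⁻¹-closed u₀∈U))) U.nonzero

  -- If u₀^q = u₀ then u₀² = u₀^(q+1) = 1, so (u₀ + 1)² = 0.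
  u₀-not-fixed : ¬ Fixed u₀
  u₀-not-fixed fixed = ^-nonzero 2 (λ eq → u₀≉1 (x+y≈0⇒x≈y eq)) (begin
    (u₀ + 1#) ^ 2            ≈⟨ frobenius-+ 1 u₀ 1# ⟩
    u₀ ^ 2 + 1# ^ 2          ≈⟨ +-cong (trans (*-congˡ (*-identityʳ u₀)) u₀²≈1) (1^n≈1 2) ⟩
    1# + 1#                  ≈⟨ x+x≈0 1# ⟩
    0#                       ∎)
    where
    u₀²≈1 : u₀ * u₀ ≈ 1#
    u₀²≈1 = begin
      u₀ * u₀             ≈⟨ *-cong (sym fixed) (sym (*-identityʳ u₀)) ⟩
      u₀ ^ q * u₀ ^ 1     ≈⟨ ^-homo-* u₀ q 1 ⟨
      u₀ ^ (q ℕ.+ 1)      ≈⟨ u₀^[q+1]≈1 ⟩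
      1#                  ∎
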